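{- Let $\phi=\frac{1+\sqrt5}{2}$ and let $\Gamma\subset SL_2(\mathbb R)$ be the group generated by $$\sigma_0=\begin{pmatrix}1&\phi\\0&1\end{pmatrix},\quad \sigma_1=\begin{pmatrix}\phi&\phi\\1&\phi\end{pmatrix},\quad \sigma_2=\begin{pmatrix}\phi&1\\\phi&\phi\end{pmatrix},\quad \sigma_3=\begin{pmatrix}1&0\\\phi&1\end{pmatrix}.$$ Let $S=\{\gamma\binom{1}{0}:\gamma\in\Gamma\}\subset\mathbb R^2$. There exist a sequence of positive numbers $\epsilon_n\to 0$ and a constant $C>0$ such that for every $n$ there are three distinct points of $S$ lying on a horizontal line segment of length $\epsilon_n$, and these three points lie in the ball centered at the origin of radius $C\epsilon_n^{ -4}$.
   Context: A horizontal line segment is a segment contained in a line $\{y=c\}$ in $\mathbb R^2$. Balls are with respect to the Euclidean norm. $\Gamma$ acts on $\mathbb R^2$ by matrix multiplication on column vectors. -}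

module Defs where

open import Level using (0ℓ)
import Level
open import Algebra.Bundles using (CommutativeRing; Group)
open import Data.Empty using (⊥-elim)
open import Data.Fin using (Fin; zero; suc)
open import Data.Integer as ℤ using (+_; +[1+_]; -[1+_])
import Data.Integer.Properties as ℤ
open import Data.Nat as ℕ using (ℕ; zero; suc)
import Data.Nat.Properties as ℕ
open import Data.Product using (Σ; ∃; _×_; _,_; proj₁; proj₂)
open import Data.Rational as ℚ using (ℚ; mkℚ; 0ℚ; 1ℚ; ½)
import Data.Rational.Properties as ℚ
import Data.Rational.Unnormalised as ℚᵘ
import Data.Rational.Unnormalised.Properties as ℚᵘ
open import Data.Sum using (_⊎_; inj₁; inj₂)
open import Relation.Binary.PropositionalEquality using (_≡_; _≢_; refl; sym; trans; cong; cong₂; subst; subst₂)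
open import Relation.Nullary using (¬_; Dec; yes; no)
open import Relation.Nullary.Decidable using (dec⇒maybe)
open import Tactic.RingSolver using (solve-∀)
open import Tactic.RingSolver.Core.AlmostCommutativeRing using (AlmostCommutativeRing; fromCommutativeRing)

module ℚ-Lemmas where
  open import Data.Rational
  open import Data.Rational.Properties
  open import Data.Rational.Solver
  open +-*-Solver

  <⇒≱ : ∀ {p q} → p < q → ¬ q ≤ p
  <⇒≱ p<q q≤p = <-irrefl refl (<-≤-trans p<q q≤p)

  ∣p∣<e : ∀ {p e} → p < e → - p < e → ∣ p ∣ < e
  ∣p∣<e {p} {e} p<e -p<e with ∣p∣≡p∨∣p∣≡-p p
  ... | inj₁ eq = subst (_< e) (sym eq) p<e
  ... | inj₂ eq = subst (_< e) (sym eq) -p<e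

  p≤∣p∣ : ∀ p → p ≤ ∣ p ∣
  p≤∣p∣ p with ≤-total 0ℚ p
  ... | inj₁ 0≤p = ≤-reflexive (sym (0≤p⇒∣p∣≡p 0≤p))
  ... | inj₂ p≤0 = ≤-trans p≤0 (0≤∣p∣ p)

  ∣p-q∣≡∣q-p∣ : ∀ p q → ∣ p - q ∣ ≡ ∣ q - p ∣
  ∣p-q∣≡∣q-p∣ p q = trans (sym (∣-p∣≡∣p∣ (p - q))) (cong ∣_∣ (solve 2 (λ p q → :- (p :- q) := q :- p) refl p q))

  ∣p-p∣≡0 : ∀ p → ∣ p - p ∣ ≡ 0ℚ
  ∣p-p∣≡0 p = cong ∣_∣ (+-inverseʳ p)

  triangle : ∀ p q r → ∣ p - r ∣ ≤ ∣ p - q ∣ + ∣ q - r ∣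
  triangle p q r = subst (λ z → ∣ z ∣ ≤ ∣ p - q ∣ + ∣ q - r ∣)
    (solve 3 (λ p q r → (p :- q) :+ (q :- r) := p :- r) refl p q r)
    (∣p+q∣≤∣p∣+∣q∣ (p - q) (q - r))

  p<q+e : ∀ {p q e} → ∣ p - q ∣ < e → p < q + e
  p<q+e {p} {q} {e} h = subst (_< q + e) (solve 2 (λ p q → q :+ (p :- q) := p) refl p q)
    (+-monoʳ-< q (≤-<-trans (p≤∣p∣ (p - q)) h))

  ∣p-q∣<e : ∀ {p q e} → p < q + e → q < p + e → ∣ p - q ∣ < e
  ∣p-q∣<e {p} {q} {e} h₁ h₂ = ∣p∣<e
    (subst (p - q <_) (solve 2 (λ q e → q :+ e :- q := e) refl q e) (+-monoˡ-< (- q) h₁))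
    (subst₂ _<_ (solve 2 (λ p q → q :- p := :- (p :- q)) refl p q) (solve 2 (λ p e → p :+ e :- p := e) refl p e)
      (+-monoˡ-< (- p) h₂))

  *-pos : ∀ {p q} → 0ℚ < p → 0ℚ < q → 0ℚ < p * q
  *-pos {p} {q} 0<p 0<q = positive⁻¹ _ {{pos*pos⇒pos p {{positive 0<p}} q {{positive 0<q}}}}

  *-nonNeg : ∀ {p q} → 0ℚ ≤ p → 0ℚ ≤ q → 0ℚ ≤ p * q
  *-nonNeg {p} {q} 0≤p 0≤q = subst (_≤ p * q) (*-zeroʳ p) (*-monoˡ-≤-nonNeg p {{nonNegative 0≤p}} 0≤q)

  *-mono : ∀ {p q r s} → 0ℚ ≤ p → 0ℚ ≤ s → p ≤ q → r ≤ s → p * r ≤ q * s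
  *-mono {p} {q} {r} {s} 0≤p 0≤s p≤q r≤s = ≤-trans
    (*-monoˡ-≤-nonNeg p {{nonNegative 0≤p}} r≤s)
    (*-monoʳ-≤-nonNeg s {{nonNegative 0≤s}} p≤q)

  p≤p+q : ∀ p {q} → 0ℚ < q → p ≤ p + q
  p≤p+q p {q} 0<q = subst (_≤ p + q) (+-identityʳ p) (+-monoʳ-≤ p (<⇒≤ 0<q))

  p≤q+p : ∀ p {q} → 0ℚ < q → p ≤ q + p
  p≤q+p p {q} 0<q = subst (_≤ q + p) (+-identityˡ p) (+-monoˡ-≤ p (<⇒≤ 0<q))

  +-pos : ∀ {p q} → 0ℚ < p → 0ℚ < q → 0ℚ < p + q
  +-pos = +-mono-<

  0<1 : 0ℚ < 1ℚ
  0<1 = positive⁻¹ 1ℚ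

  half-pos : ∀ {e} → 0ℚ < e → 0ℚ < e * ½
  half-pos 0<e = *-pos 0<e (positive⁻¹ ½)

  half+half : ∀ e → e * ½ + e * ½ ≡ e
  half+half = solve 1 (λ e → e :* con ½ :+ e :* con ½ := e) refl

  recip : ∀ {p} → 0ℚ < p → Σ ℚ λ q → 0ℚ < q × p * q ≡ 1ℚ
  recip {p} 0<p = (1/ p) {{>-nonZero 0<p}} , positive⁻¹ _ {{1/pos⇒pos p {{positive 0<p}}}} , *-inverseʳ p {{>-nonZero 0<p}}

  divide : ∀ {b e} → 0ℚ < b → 0ℚ < e → Σ ℚ λ d → 0ℚ < d × b * d ≡ e
  divide {b} {e} 0<b 0<e with recip 0<b
  ... | q , 0<q , bq≡1 = q * e , *-pos 0<q 0<e ,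
    trans (sym (*-assoc b q e)) (trans (cong (_* e) bq≡1) (*-identityˡ e))

  square-cancel-< : ∀ {p q} → 0ℚ ≤ q → p * p < q * q → p < q
  square-cancel-< {p} {q} 0≤q pp<qq with p <? q
  ... | yes p<q = p<q
  ... | no p≮q = ⊥-elim (<⇒≱ pp<qq (*-mono 0≤q (≤-trans 0≤q (≮⇒≥ p≮q)) (≮⇒≥ p≮q) (≮⇒≥ p≮q)))

  mesh : ℕ → ℚ
  mesh n = + 1 / suc n

  0<mesh : ∀ n → 0ℚ < mesh n
  0<mesh n = positive⁻¹ _ {{normalize-pos 1 (suc n)}}

  mesh≤1 : ∀ n → mesh n ≤ 1ℚ
  mesh≤1 n = toℚᵘ-cancel-≤ (ℚᵘ.≤-trans (ℚᵘ.≤-reflexive (toℚᵘ-fromℚᵘ (ℚᵘ.mkℚᵘ (+ 1) n)))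
    (ℚᵘ.*≤* (ℤ.+≤+ (ℕ.s≤s ℕ.z≤n))))

  mesh-small : ∀ {e} → 0ℚ < e → ∃ λ N → ∀ n → N ℕ.≤ n → mesh n < e
  mesh-small {mkℚ (+ zero) d _} (*<* (ℤ.+<+ ()))
  mesh-small {e@(mkℚ +[1+ k ] d _)} _ = suc d , λ n d<n →
    toℚᵘ-cancel-< (ℚᵘ.≤-<-trans (ℚᵘ.≤-reflexive (toℚᵘ-fromℚᵘ (ℚᵘ.mkℚᵘ (+ 1) n)))
      (ℚᵘ.*<* (ℤ.+<+ (ℕ.<-≤-trans
        (ℕ.s≤s (subst (ℕ._< n) (sym (ℕ.+-identityʳ d)) d<n)) (ℕ.m≤m+n (suc n) (k ℕ.* suc n))))))
  mesh-small {mkℚ -[1+ _ ] d _} (*<* ())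

  grid : ℕ → ℕ → ℚ
  grid n k = + k / suc n

  toℚᵘ-grid : ∀ n k → toℚᵘ (grid n k) ℚᵘ.≃ ℚᵘ.mkℚᵘ (+ k) n
  toℚᵘ-grid n k = toℚᵘ-fromℚᵘ (ℚᵘ.mkℚᵘ (+ k) n)

  grid-nonNeg : ∀ n k → 0ℚ ≤ grid n k
  grid-nonNeg n k = nonNegative⁻¹ _ {{normalize-nonNeg k (suc n)}}

  grid-suc : ∀ n k → grid n (suc k) ≡ grid n k + mesh n
  grid-suc n k = toℚᵘ-injective (ℚᵘ.≃-trans (toℚᵘ-grid n (suc k)) (ℚᵘ.≃-sym
    (ℚᵘ.≃-trans (toℚᵘ-homo-+ (grid n k) (mesh n))
    (ℚᵘ.≃-trans (ℚᵘ.+-cong (toℚᵘ-grid n k) (toℚᵘ-fromℚᵘ (ℚᵘ.mkℚᵘ (+ 1) n)))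
    (ℚᵘ.*≡* (lemma (+ k) (+ suc n)))))))
    where
    open import Data.Integer.Solver using () renaming (module +-*-Solver to ℤS)
    lemma : ∀ k n → (k ℤ.* n ℤ.+ + 1 ℤ.* n) ℤ.* n ≡ (+ 1 ℤ.+ k) ℤ.* (n ℤ.* n)
    lemma = ℤS.solve 2 (λ k n → (k ℤS.:* n ℤS.:+ ℤS.con (+ 1) ℤS.:* n) ℤS.:* n
      ℤS.:= (ℤS.con (+ 1) ℤS.:+ k) ℤS.:* (n ℤS.:* n)) refl

  grid-unbounded : ∀ n q → ∃ λ k → q ≤ grid n k
  grid-unbounded n q@(mkℚ (+ c) d _) = c ℕ.* suc n , toℚᵘ-cancel-≤ (ℚᵘ.≤-trans
    (ℚᵘ.*≤* (ℤ.≤-trans (ℤ.≤-reflexive (sym (ℤ.pos-* c (suc n)))) (ℤ.≤-trans (ℤ.+≤+ (ℕ.m≤m*n (c ℕ.* suc n) (suc d))) (ℤ.≤-reflexive (ℤ.pos-* (c ℕ.* suc n) (suc d))))))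
    (ℚᵘ.≤-reflexive (ℚᵘ.≃-sym (toℚᵘ-grid n (c ℕ.* suc n)))))
  grid-unbounded n q@(mkℚ -[1+ _ ] d _) = 0 , ≤-trans (<⇒≤ (negative⁻¹ q)) (grid-nonNeg n 0)

  search : ∀ {P : ℕ → Set} → (∀ k → Dec (P k)) → P 0 → ∀ K → ¬ P K → ∃ λ k → P k × ¬ P (suc k)
  search P? P0 zero ¬PK = ⊥-elim (¬PK P0)
  search P? P0 (suc K) ¬PK with P? K
  ... | yes PK = K , PK , ¬PK
  ... | no ¬P′ = search P? P0 K ¬P′

  record RootApprox (q h : ℚ) : Set where
    field
      root   : ℚ
      root≥0 : 0ℚ ≤ root
      lower  : root * root ≤ 0ℚ ⊔ q
      upper  : 0ℚ ⊔ q < (root + h) * (root + h)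

  abstract
    rootApprox : ∀ q n → RootApprox q (mesh n)
    rootApprox q n = record
      { root   = grid n (proj₁ found)
      ; root≥0 = grid-nonNeg n (proj₁ found)
      ; lower  = proj₁ (proj₂ found)
      ; upper  = ≰⇒> (subst (λ a → ¬ a * a ≤ 0ℚ ⊔ q) (grid-suc n (proj₁ found)) (proj₂ (proj₂ found)))
      }
      where
      P : ℕ → Set
      P k = grid n k * grid n k ≤ 0ℚ ⊔ q
      c : ℚ
      c = 1ℚ + (0ℚ ⊔ q)
      K : ∃ λ k → c ≤ grid n k
      K = grid-unbounded n c
      0≤q⁺ : 0ℚ ≤ 0ℚ ⊔ q
      0≤q⁺ = p≤p⊔q 0ℚ q
      1≤c : 1ℚ ≤ c
      1≤c = subst (_≤ c) (+-identityʳ 1ℚ) (+-monoʳ-≤ 1ℚ 0≤q⁺)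
      0≤c : 0ℚ ≤ c
      0≤c = ≤-trans (<⇒≤ 0<1) 1≤c
      q⁺<c : 0ℚ ⊔ q < c
      q⁺<c = subst (_< c) (+-identityˡ (0ℚ ⊔ q)) (+-monoˡ-< (0ℚ ⊔ q) 0<1)
      c≤cc : c ≤ c * c
      c≤cc = subst (_≤ c * c) (*-identityˡ c) (*-monoʳ-≤-nonNeg c {{nonNegative 0≤c}} 1≤c)
      ¬PK : ¬ P (proj₁ K)
      ¬PK = <⇒≱ (<-≤-trans q⁺<c (≤-trans c≤cc (*-mono 0≤c (grid-nonNeg n (proj₁ K)) (proj₂ K) (proj₂ K))))
      P0 : P 0
      P0 = subst (λ a → a * a ≤ 0ℚ ⊔ q) (sym (grid0 n)) 0≤q⁺
        where
        grid0 : ∀ n → grid n 0 ≡ 0ℚ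
        grid0 n = toℚᵘ-injective (ℚᵘ.≃-trans (toℚᵘ-grid n 0) (ℚᵘ.*≡* refl))
      found : ∃ λ k → P k × ¬ P (suc k)
      found = search {P} (λ k → grid n k * grid n k ≤? 0ℚ ⊔ q) P0 (proj₁ K) ¬PK

  ring : AlmostCommutativeRing _ _
  ring = fromCommutativeRing +-*-commutativeRing (λ p → dec⇒maybe (0ℚ ≟ p))

  det-* : ∀ a b c d a′ b′ c′ d′ →
    (a * a′ + b * c′) * (c * b′ + d * d′) + - ((a * b′ + b * d′) * (c * a′ + d * c′))
    ≡ (a * d + - (b * c)) * (a′ * d′ + - (b′ * c′))
  det-* = solve-∀ ring

  det-adj : ∀ a b c d → d * a - (- b) * (- c) ≡ a * d - b * c
  det-adj = solve 4 (λ a b c d → d :* a :- (:- b) :* (:- c) := a :* d :- b :* c) refl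

  row-assoc : ∀ a b p q r s u v →
    (a * p + b * r) * u + (a * q + b * s) * v ≡ a * (p * u + q * v) + b * (r * u + s * v)
  row-assoc = solve-∀ ring

  unit₁ : ∀ p q → 1ℚ * p + 0ℚ * q ≡ p
  unit₁ = solve 2 (λ p q → con 1ℚ :* p :+ con 0ℚ :* q := p) refl

  unit₂ : ∀ p q → 0ℚ * p + 1ℚ * q ≡ q
  unit₂ = solve 2 (λ p q → con 0ℚ :* p :+ con 1ℚ :* q := q) refl

  unit₃ : ∀ p q → p * 1ℚ + q * 0ℚ ≡ p
  unit₃ = solve 2 (λ p q → p :* con 1ℚ :+ q :* con 0ℚ := p) refl

  unit₄ : ∀ p q → p * 0ℚ + q * 1ℚ ≡ q
  unit₄ = solve 2 (λ p q → p :* con 0ℚ :+ q :* con 1ℚ := q) refl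

  vanish₁ : ∀ p q → p * - q + q * p ≡ 0ℚ
  vanish₁ = solve 2 (λ p q → p :* :- q :+ q :* p := con 0ℚ) refl

  vanish₂ : ∀ p q → p * q + - q * p ≡ 0ℚ
  vanish₂ = solve 2 (λ p q → p :* q :+ :- q :* p := con 0ℚ) refl

  vanish₀ : ∀ p q → - q * p + p * q ≡ 0ℚ
  vanish₀ = solve 2 (λ p q → :- q :* p :+ p :* q := con 0ℚ) refl

  vanish₃ : ∀ p q → p * q + q * - p ≡ 0ℚ
  vanish₃ = solve 2 (λ p q → p :* q :+ q :* :- p := con 0ℚ) refl

  det-upper : ∀ p → 1ℚ * 1ℚ - p * 0ℚ ≡ 1ℚ
  det-upper = solve 1 (λ p → con 1ℚ :* con 1ℚ :- p :* con 0ℚ := con 1ℚ) refl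

  det-lower : ∀ p → 1ℚ * 1ℚ - 0ℚ * p ≡ 1ℚ
  det-lower = solve 1 (λ p → con 1ℚ :* con 1ℚ :- con 0ℚ :* p := con 1ℚ) refl

  det₁ : ∀ a b c d → a * d + b * - c ≡ a * d - b * c
  det₁ = solve 4 (λ a b c d → a :* d :+ b :* :- c := a :* d :- b :* c) refl

  det₂ : ∀ a b c d → c * - b + d * a ≡ a * d - b * c
  det₂ = solve 4 (λ a b c d → c :* :- b :+ d :* a := a :* d :- b :* c) refl

  det₃ : ∀ a b c d → d * a + - b * c ≡ a * d - b * c
  det₃ = solve 4 (λ a b c d → d :* a :+ :- b :* c := a :* d :- b :* c) refl

  det₄ : ∀ a b c d → - c * b + a * d ≡ a * d - b * c
  det₄ = solve 4 (λ a b c d → :- c :* b :+ a :* d := a :* d :- b :* c) refl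

  ¼ : ℚ
  ¼ = + 1 / 4

  golden : ∀ s → ½ * (1ℚ + s) * (½ * (1ℚ + s)) - ½ * (1ℚ + s) ≡ ¼ * (s * s) - ¼
  golden = solve 1 (λ s → con ½ :* (con 1ℚ :+ s) :* (con ½ :* (con 1ℚ :+ s)) :- con ½ :* (con 1ℚ :+ s)
    := con ¼ :* (s :* s) :- con ¼) refl

  inv₀ : ℚ → ℚ
  inv₀ p with p ≟ 0ℚ
  ... | yes _  = 0ℚ
  ... | no p≢0 = (1/ p) {{≢-nonZero p≢0}}

  inv₀-inverse : ∀ {p} → p ≢ 0ℚ → p * inv₀ p ≡ 1ℚ
  inv₀-inverse {p} p≢0 with p ≟ 0ℚ
  ... | yes p≡0 = ⊥-elim (p≢0 p≡0)
  ... | no p≢0′ = *-inverseʳ p {{≢-nonZero p≢0′}}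

  0<∣p∣⇒p≢0 : ∀ {p} → 0ℚ < ∣ p ∣ → p ≢ 0ℚ
  0<∣p∣⇒p≢0 0<∣p∣ refl = <-irrefl refl 0<∣p∣

  inv₀-bound : ∀ {a d D} → 0ℚ < d → 0ℚ < D → d * D ≡ 1ℚ → d ≤ ∣ a ∣ → ∣ inv₀ a ∣ ≤ D
  inv₀-bound {a} {d} {D} 0<d 0<D dD≡1 d≤∣a∣ = subst₂ _≤_
    (trans (*-assoc ∣ inv₀ a ∣ d D) (trans (cong (∣ inv₀ a ∣ *_) dD≡1) (*-identityʳ ∣ inv₀ a ∣)))
    (trans (cong (_* D) ia*a≡1) (*-identityˡ D))
    (*-monoʳ-≤-nonNeg D {{nonNegative (<⇒≤ 0<D)}} (*-monoˡ-≤-nonNeg ∣ inv₀ a ∣ {{∣-∣-nonNeg (inv₀ a)}} d≤∣a∣))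
    where
    ia*a≡1 : ∣ inv₀ a ∣ * ∣ a ∣ ≡ 1ℚ
    ia*a≡1 = trans (*-comm ∣ inv₀ a ∣ ∣ a ∣) (trans (sym (∣p*q∣≡∣p∣*∣q∣ a (inv₀ a)))
      (cong ∣_∣ (inv₀-inverse (0<∣p∣⇒p≢0 (<-≤-trans 0<d d≤∣a∣)))))

  inv₀-estimate : ∀ {a b d D δ e} → 0ℚ < d → 0ℚ < D → d * D ≡ 1ℚ → D * D * δ ≡ e →
    d ≤ ∣ a ∣ → d ≤ ∣ b ∣ → ∣ a - b ∣ < δ → ∣ inv₀ a - inv₀ b ∣ < e
  inv₀-estimate {a} {b} {d} {D} {δ} {e} 0<d 0<D dD≡1 DDδ≡e d≤∣a∣ d≤∣b∣ ∣a-b∣<δ =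
    subst₂ (λ u v → ∣ u ∣ < v) (sym difference) DDδ≡e
    (≤-<-trans
      (subst (_≤ D * D * ∣ b - a ∣) (sym (trans (∣p*q∣≡∣p∣*∣q∣ (ia * ib) (b - a)) (cong (_* ∣ b - a ∣) (∣p*q∣≡∣p∣*∣q∣ ia ib))))
        (*-monoʳ-≤-nonNeg ∣ b - a ∣ {{∣-∣-nonNeg (b - a)}}
          (*-mono (0≤∣p∣ ia) (<⇒≤ 0<D) (inv₀-bound {a} 0<d 0<D dD≡1 d≤∣a∣) (inv₀-bound {b} 0<d 0<D dD≡1 d≤∣b∣))))
      (*-monoʳ-<-pos (D * D) {{positive (*-pos 0<D 0<D)}} (subst (_< δ) (∣p-q∣≡∣q-p∣ a b) ∣a-b∣<δ)))
    where
    ia = inv₀ a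
    ib = inv₀ b
    difference : ia - ib ≡ (ia * ib) * (b - a)
    difference = sym (trans
      (solve 4 (λ a b ia ib → (ia :* ib) :* (b :- a) := ia :* (b :* ib) :- ib :* (a :* ia)) refl a b ia ib)
      (trans (cong₂ (λ u v → ia * u - ib * v)
        (inv₀-inverse (0<∣p∣⇒p≢0 (<-≤-trans 0<d d≤∣b∣)))
        (inv₀-inverse (0<∣p∣⇒p≢0 (<-≤-trans 0<d d≤∣a∣))))
      (cong₂ _-_ (*-identityʳ ia) (*-identityʳ ib))))

  +-estimate : ∀ {a a′ b b′ e} → ∣ a - a′ ∣ < e * ½ → ∣ b - b′ ∣ < e * ½ → ∣ (a + b) - (a′ + b′) ∣ < e
  +-estimate {a} {a′} {b} {b′} {e} h₁ h₂ = subst₂ (λ u v → ∣ u ∣ < v)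
    (solve 4 (λ a a′ b b′ → (a :- a′) :+ (b :- b′) := (a :+ b) :- (a′ :+ b′)) refl a a′ b b′)
    (half+half e)
    (≤-<-trans (∣p+q∣≤∣p∣+∣q∣ (a - a′) (b - b′)) (+-mono-< h₁ h₂))

  neg-estimate : ∀ {a b e} → ∣ a - b ∣ < e → ∣ (- a) - (- b) ∣ < e
  neg-estimate {a} {b} {e} = subst (_< e) (trans (∣p-q∣≡∣q-p∣ a b)
    (cong ∣_∣ (solve 2 (λ a b → b :- a := (:- a) :- (:- b)) refl a b)))

  *-estimate : ∀ {a a′ b b′ B δ e} → 0ℚ < B → B * δ ≡ e * ½ → ∣ a ∣ ≤ B → ∣ b′ ∣ ≤ B →
    ∣ a - a′ ∣ < δ → ∣ b - b′ ∣ < δ → ∣ a * b - a′ * b′ ∣ < e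
  *-estimate {a} {a′} {b} {b′} {B} {δ} {e} 0<B Bδ ∣a∣≤B ∣b′∣≤B h₁ h₂ = subst₂ (λ u v → ∣ u ∣ < v)
    (solve 4 (λ a a′ b b′ → a :* (b :- b′) :+ b′ :* (a :- a′) := a :* b :- a′ :* b′) refl a a′ b b′)
    (half+half e)
    (≤-<-trans (∣p+q∣≤∣p∣+∣q∣ (a * (b - b′)) (b′ * (a - a′)))
      (+-mono-< (part a (b - b′) ∣a∣≤B h₂) (part b′ (a - a′) ∣b′∣≤B h₁)))
    where
    part : ∀ p q → ∣ p ∣ ≤ B → ∣ q ∣ < δ → ∣ p * q ∣ < e * ½
    part p q ∣p∣≤B ∣q∣<δ = subst₂ _<_ (sym (∣p*q∣≡∣p∣*∣q∣ p q)) Bδ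
      (≤-<-trans (*-monoʳ-≤-nonNeg ∣ q ∣ {{∣-∣-nonNeg q}} ∣p∣≤B) (*-monoʳ-<-pos B {{positive 0<B}} ∣q∣<δ))

  root-estimate : ∀ {p q h k δ} → 0ℚ < h → 0ℚ < δ → (P : RootApprox p k) (Q : RootApprox q h) →
    ∣ p - q ∣ < δ * δ → RootApprox.root P < RootApprox.root Q + (h + δ)
  root-estimate {p} {q} {h} {k} {δ} 0<h 0<δ P Q ∣p-q∣<δδ = square-cancel-< 0≤s
    (≤-<-trans P.lower (≤-<-trans p⁺≤ (<-≤-trans (+-monoˡ-< (δ * δ) Q.upper) squares)))
    where
    module P = RootApprox P
    module Q = RootApprox Q
    b = Q.root
    0≤b+h : 0ℚ ≤ b + h
    0≤b+h = +-mono-≤ Q.root≥0 (<⇒≤ 0<h)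
    0≤s : 0ℚ ≤ b + (h + δ)
    0≤s = +-mono-≤ Q.root≥0 (+-mono-≤ (<⇒≤ 0<h) (<⇒≤ 0<δ))
    0≤δδ : 0ℚ ≤ δ * δ
    0≤δδ = <⇒≤ (*-pos 0<δ 0<δ)
    p⁺≤ : 0ℚ ⊔ p ≤ (0ℚ ⊔ q) + δ * δ
    p⁺≤ = ⊔-lub {y = 0ℚ} {z = p} (+-mono-≤ (p≤p⊔q 0ℚ q) 0≤δδ)
      (≤-trans (<⇒≤ (p<q+e {p} {q} ∣p-q∣<δδ)) (+-monoˡ-≤ (δ * δ) (p≤q⊔p 0ℚ q)))
    squares : (b + h) * (b + h) + δ * δ ≤ (b + (h + δ)) * (b + (h + δ))
    squares = subst₂ _≤_ (+-identityʳ _)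
      (solve 3 (λ b h δ → ((b :+ h) :* (b :+ h) :+ δ :* δ) :+ ((b :+ h) :* δ :+ (b :+ h) :* δ)
        := (b :+ (h :+ δ)) :* (b :+ (h :+ δ))) refl b h δ)
      (+-monoʳ-≤ ((b + h) * (b + h) + δ * δ)
        (+-mono-≤ (*-nonNeg 0≤b+h (<⇒≤ 0<δ)) (*-nonNeg 0≤b+h (<⇒≤ 0<δ))))

  root-square-estimate : ∀ {q h A δ e} → 0ℚ < h → h ≤ 1ℚ → 0ℚ < A → A * δ ≡ e → 0ℚ < e → (Q : RootApprox q h) →
    ∣ RootApprox.root Q ∣ + ∣ RootApprox.root Q ∣ + 1ℚ ≤ A → h < δ → 0ℚ < q + e →
    ∣ RootApprox.root Q * RootApprox.root Q - q ∣ < e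
  root-square-estimate {q} {h} {A} {δ} {e} 0<h h≤1 0<A Aδ≡e 0<e Q bound h<δ 0<q+e = ∣p-q∣<e
    (≤-<-trans Q.lower (⊔-<  0<q+e (subst (_< q + e) (+-identityʳ q) (+-monoʳ-< q 0<e))))
    (≤-<-trans (p≤q⊔p 0ℚ q) (<-trans Q.upper (subst (_< b * b + e) (solve 2 (λ b h → b :* b :+ (b :+ b :+ h) :* h := (b :+ h) :* (b :+ h)) refl b h)
      (+-monoʳ-< (b * b) (≤-<-trans
        (*-monoʳ-≤-nonNeg h {{nonNegative (<⇒≤ 0<h)}} (≤-trans (+-mono-≤ (+-mono-≤ (p≤∣p∣ b) (p≤∣p∣ b)) h≤1) bound))
        (subst (A * h <_) Aδ≡e (*-monoʳ-<-pos A {{positive 0<A}} h<δ)))))))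
    where
    module Q = RootApprox Q
    b = Q.root
    ⊔-< : ∀ {r s t} → r < t → s < t → r ⊔ s < t
    ⊔-< {r} {s} {t} r<t s<t with ≤-total r s
    ... | inj₁ r≤s = subst (_< t) (sym (p≤q⇒p⊔q≡q r≤s)) s<t
    ... | inj₂ s≤r = subst (_< t) (sym (p≥q⇒p⊔q≡p s≤r)) r<t

open ℚ-Lemmas

Eventually : (ℕ → Set) → Set
Eventually P = ∃ λ N → ∀ n → N ℕ.≤ n → P n

IsCauchy : (ℕ → ℚ) → Set
IsCauchy s = ∀ e → 0ℚ ℚ.< e → ∃ λ N → ∀ m n → N ℕ.≤ m → N ℕ.≤ n → ℚ.∣ s m ℚ.- s n ∣ ℚ.< e

-- Real numbers are Cauchy sequences of rationals; equality of reals is the setoid relation _≈_ below.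
record ℝ : Set where
  no-eta-equality
  constructor mkℝ
  field
    seq      : ℕ → ℚ
    isCauchy : IsCauchy seq

open ℝ public

infix 4 _≈_ _<_ _≤_ _#_

record _≈_ (x y : ℝ) : Set where
  constructor mk≈
  field
    close : ∀ e → 0ℚ ℚ.< e → Eventually λ n → ℚ.∣ seq x n ℚ.- seq y n ∣ ℚ.< e

record _<_ (x y : ℝ) : Set where
  constructor mk<
  field
    gap      : ℚ
    gap>0    : 0ℚ ℚ.< gap
    separate : Eventually λ n → seq x n ℚ.+ gap ℚ.≤ seq y n

record _≤_ (x y : ℝ) : Set where
  constructor mk≤
  field
    below : ∀ e → 0ℚ ℚ.< e → Eventually λ n → seq x n ℚ.< seq y n ℚ.+ e

open _≈_ public
open _<_ public
open _≤_ public

-- Apartness, the constructive form of "x and y are distinct".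
_#_ : ℝ → ℝ → Set
x # y = x < y ⊎ y < x

both : ∀ {P Q R : ℕ → Set} → (∀ n → P n → Q n → R n) → Eventually P → Eventually Q → Eventually R
both f (M , p) (N , q) = M ℕ.⊔ N , λ n h →
  f n (p n (ℕ.≤-trans (ℕ.m≤m⊔n M N) h)) (q n (ℕ.≤-trans (ℕ.m≤n⊔m M N) h))

bounded : ∀ x → ∃ λ B → 0ℚ ℚ.< B × Eventually λ n → ℚ.∣ seq x n ∣ ℚ.≤ B
bounded x with isCauchy x 1ℚ 0<1
... | N , h = B , 0<B , N , λ n N≤n → ℚ.≤-trans
  (subst (λ z → ℚ.∣ z ∣ ℚ.≤ ℚ.∣ s n ℚ.- s N ∣ ℚ.+ ℚ.∣ s N ∣)
    (solve 2 (λ p q → (p :- q) :+ q := p) refl (s n) (s N))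
    (ℚ.∣p+q∣≤∣p∣+∣q∣ (s n ℚ.- s N) (s N)))
  (ℚ.+-monoˡ-≤ ℚ.∣ s N ∣ (ℚ.<⇒≤ (h n N N≤n ℕ.≤-refl)))
  where
  open import Data.Rational.Solver
  open +-*-Solver
  s = seq x
  B = 1ℚ ℚ.+ ℚ.∣ s N ∣
  0<B : 0ℚ ℚ.< B
  0<B = ℚ.+-mono-<-≤ 0<1 (ℚ.0≤∣p∣ (s N))

bounded₂ : ∀ x y → ∃ λ B → 0ℚ ℚ.< B ×
  Eventually (λ n → ℚ.∣ seq x n ∣ ℚ.≤ B) × Eventually (λ n → ℚ.∣ seq y n ∣ ℚ.≤ B)
bounded₂ x y =
  let (B , 0<B , M , p) = bounded x
      (C , 0<C , N , q) = bounded y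
  in B ℚ.+ C , +-pos 0<B 0<C ,
    (M , λ n h → ℚ.≤-trans (p n h) (p≤p+q B 0<C)) ,
    (N , λ n h → ℚ.≤-trans (q n h) (p≤q+p C 0<B))

infixl 6 _+_ _-_
infixl 7 _*_
infix  8 -_

fromℚ : ℚ → ℝ
fromℚ q = mkℝ (λ _ → q) λ e 0<e → 0 , λ _ _ _ _ → subst (ℚ._< e) (sym (∣p-p∣≡0 q)) 0<e

0ℝ 1ℝ : ℝ
0ℝ = fromℚ 0ℚ
1ℝ = fromℚ 1ℚ

abstract
  +-isCauchy : ∀ x y → IsCauchy (λ n → seq x n ℚ.+ seq y n)
  +-isCauchy x y e 0<e =
    let (M , p) = isCauchy x (e ℚ.* ½) (half-pos 0<e)
        (N , q) = isCauchy y (e ℚ.* ½) (half-pos 0<e)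
    in M ℕ.+ N , λ m n hm hn → +-estimate {seq x m} {seq x n} {seq y m} {seq y n} {e}
      (p m n (ℕ.m+n≤o⇒m≤o M hm) (ℕ.m+n≤o⇒m≤o M hn))
      (q m n (ℕ.m+n≤o⇒n≤o M hm) (ℕ.m+n≤o⇒n≤o M hn))

  neg-isCauchy : ∀ x → IsCauchy (λ n → ℚ.- seq x n)
  neg-isCauchy x e 0<e = let (N , p) = isCauchy x e 0<e in
    N , λ m n hm hn → neg-estimate {seq x m} {seq x n} {e} (p m n hm hn)

  *-isCauchy : ∀ x y → IsCauchy (λ n → seq x n ℚ.* seq y n)
  *-isCauchy x y e 0<e =
    let (B , 0<B , (K , bx) , (L , by)) = bounded₂ x y
        (δ , 0<δ , Bδ) = divide 0<B (half-pos 0<e)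
        (M , p) = isCauchy x δ 0<δ
        (N , q) = isCauchy y δ 0<δ
    in (K ℕ.+ L) ℕ.+ (M ℕ.+ N) , λ m n hm hn →
      *-estimate {seq x m} {seq x n} {seq y m} {seq y n} {B} {δ} {e} 0<B Bδ
      (bx m (ℕ.m+n≤o⇒m≤o K (ℕ.m+n≤o⇒m≤o (K ℕ.+ L) hm)))
      (by n (ℕ.m+n≤o⇒n≤o K (ℕ.m+n≤o⇒m≤o (K ℕ.+ L) hn)))
      (p m n (ℕ.m+n≤o⇒m≤o M (ℕ.m+n≤o⇒n≤o (K ℕ.+ L) hm)) (ℕ.m+n≤o⇒m≤o M (ℕ.m+n≤o⇒n≤o (K ℕ.+ L) hn)))
      (q m n (ℕ.m+n≤o⇒n≤o M (ℕ.m+n≤o⇒n≤o (K ℕ.+ L) hm)) (ℕ.m+n≤o⇒n≤o M (ℕ.m+n≤o⇒n≤o (K ℕ.+ L) hn)))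

_+_ : ℝ → ℝ → ℝ
x + y = mkℝ (λ n → seq x n ℚ.+ seq y n) (+-isCauchy x y)

-_ : ℝ → ℝ
- x = mkℝ (λ n → ℚ.- seq x n) (neg-isCauchy x)

_-_ : ℝ → ℝ → ℝ
x - y = x + - y

_*_ : ℝ → ℝ → ℝ
x * y = mkℝ (λ n → seq x n ℚ.* seq y n) (*-isCauchy x y)

away-from-0 : ∀ x → x # 0ℝ → ∃ λ d → 0ℚ ℚ.< d × Eventually λ n → d ℚ.≤ ℚ.∣ seq x n ∣
away-from-0 x (inj₂ (mk< d 0<d (N , h))) = d , 0<d , N , λ n N≤n →
  ℚ.≤-trans (subst (ℚ._≤ seq x n) (ℚ.+-identityˡ d) (h n N≤n)) (p≤∣p∣ (seq x n))
away-from-0 x (inj₁ (mk< d 0<d (N , h))) = d , 0<d , N , λ n N≤n → ℚ.≤-trans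
  (subst₂ ℚ._≤_ (solve 2 (λ p d → (p :+ d) :- p := d) refl (seq x n) d) (ℚ.+-identityˡ (ℚ.- seq x n))
    (ℚ.+-monoˡ-≤ (ℚ.- seq x n) (h n N≤n)))
  (subst (ℚ.- seq x n ℚ.≤_) (ℚ.∣-p∣≡∣p∣ (seq x n)) (p≤∣p∣ (ℚ.- seq x n)))
  where
  open import Data.Rational.Solver
  open +-*-Solver

abstract
  inv-isCauchy : ∀ x → x # 0ℝ → IsCauchy (λ n → inv₀ (seq x n))
  inv-isCauchy x x#0 e 0<e =
    let (d , 0<d , N , h) = away-from-0 x x#0
        (D , 0<D , dD≡1) = recip 0<d
        (δ , 0<δ , DDδ≡e) = divide (*-pos 0<D 0<D) 0<e
        (M , p) = isCauchy x δ 0<δ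
    in N ℕ.+ M , λ m n hm hn → inv₀-estimate {seq x m} {seq x n} {d} {D} {δ} {e} 0<d 0<D dD≡1 DDδ≡e
      (h m (ℕ.m+n≤o⇒m≤o N hm)) (h n (ℕ.m+n≤o⇒m≤o N hn))
      (p m n (ℕ.m+n≤o⇒n≤o N hm) (ℕ.m+n≤o⇒n≤o N hn))

-- The sequence is n ↦ 1 / xₙ; the finitely many terms with xₙ = 0, if any, are replaced by 0.
inv : (x : ℝ) → x # 0ℝ → ℝ
inv x x#0 = mkℝ (λ n → inv₀ (seq x n)) (inv-isCauchy x x#0)

-- The largest multiple k / (n + 1) whose square is at most max(0, xₙ).
√-seq : ℝ → ℕ → ℚ
√-seq x n = RootApprox.root (rootApprox (seq x n) n)

abstract
  √-close : ∀ x {e} → 0ℚ ℚ.< e → ∀ m n → mesh n ℚ.< e ℚ.* ½ →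
    ℚ.∣ seq x m ℚ.- seq x n ∣ ℚ.< e ℚ.* ½ ℚ.* (e ℚ.* ½) → √-seq x m ℚ.< √-seq x n ℚ.+ e
  √-close x {e} 0<e m n small near = ℚ.<-trans
    (root-estimate {seq x m} {seq x n} {mesh n} {mesh m} {e ℚ.* ½} (0<mesh n) (half-pos 0<e)
      (rootApprox (seq x m) m) (rootApprox (seq x n) n) near)
    (ℚ.+-monoʳ-< (√-seq x n) (subst (mesh n ℚ.+ e ℚ.* ½ ℚ.<_) (half+half e) (ℚ.+-monoˡ-< (e ℚ.* ½) small)))

  √-isCauchy : ∀ x → IsCauchy (√-seq x)
  √-isCauchy x e 0<e =
    let (M , small) = mesh-small (half-pos 0<e)
        (N , p) = isCauchy x (e ℚ.* ½ ℚ.* (e ℚ.* ½)) (*-pos (half-pos 0<e) (half-pos 0<e))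
    in M ℕ.+ N , λ m n hm hn → ∣p-q∣<e {√-seq x m} {√-seq x n} {e}
      (√-close x 0<e m n (small n (ℕ.m+n≤o⇒m≤o M hn)) (p m n (ℕ.m+n≤o⇒n≤o M hm) (ℕ.m+n≤o⇒n≤o M hn)))
      (√-close x 0<e n m (small m (ℕ.m+n≤o⇒m≤o M hm)) (p n m (ℕ.m+n≤o⇒n≤o M hn) (ℕ.m+n≤o⇒n≤o M hm)))

√ : ℝ → ℝ
√ x = mkℝ (√-seq x) (√-isCauchy x)

-- Real arithmetic is termwise, so an identity of rational terms gives an equality of reals.
pointwise : ∀ {x y} → (∀ n → seq x n ≡ seq y n) → x ≈ y
pointwise {x} {y} h = mk≈ λ e 0<e → 0 , λ n _ →
  subst (ℚ._< e) (sym (trans (cong (λ z → ℚ.∣ z ℚ.- seq y n ∣) (h n)) (∣p-p∣≡0 (seq y n)))) 0<e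

≈-refl : ∀ {x} → x ≈ x
≈-refl = pointwise λ _ → refl

≈-sym : ∀ {x y} → x ≈ y → y ≈ x
≈-sym {x} {y} x≈y = mk≈ λ e 0<e → let (N , h) = close x≈y e 0<e in
  N , λ n N≤n → subst (ℚ._< e) (∣p-q∣≡∣q-p∣ (seq x n) (seq y n)) (h n N≤n)

≈-trans : ∀ {x y z} → x ≈ y → y ≈ z → x ≈ z
≈-trans {x} {y} {z} x≈y y≈z = mk≈ λ e 0<e → both
  (λ n p q → subst (ℚ.∣ seq x n ℚ.- seq z n ∣ ℚ.<_) (half+half e)
    (ℚ.≤-<-trans (triangle (seq x n) (seq y n) (seq z n)) (ℚ.+-mono-< p q)))
  (close x≈y (e ℚ.* ½) (half-pos 0<e)) (close y≈z (e ℚ.* ½) (half-pos 0<e))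

+-cong : ∀ {x x′ y y′} → x ≈ x′ → y ≈ y′ → x + y ≈ x′ + y′
+-cong {x} {x′} {y} {y′} x≈x′ y≈y′ = mk≈ λ e 0<e → both
  (λ n p q → +-estimate {seq x n} {seq x′ n} {seq y n} {seq y′ n} {e} p q)
  (close x≈x′ (e ℚ.* ½) (half-pos 0<e)) (close y≈y′ (e ℚ.* ½) (half-pos 0<e))

-‿cong : ∀ {x y} → x ≈ y → - x ≈ - y
-‿cong {x} {y} x≈y = mk≈ λ e 0<e → let (N , h) = close x≈y e 0<e in
  N , λ n N≤n → neg-estimate {seq x n} {seq y n} {e} (h n N≤n)

*-cong : ∀ {x x′ y y′} → x ≈ x′ → y ≈ y′ → x * y ≈ x′ * y′
*-cong {x} {x′} {y} {y′} x≈x′ y≈y′ = mk≈ λ e 0<e →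
  let (B , 0<B , bx , by) = bounded₂ x y′
      (δ , 0<δ , Bδ) = divide 0<B (half-pos 0<e)
  in both (λ n (p , q) (u , v) → *-estimate {seq x n} {seq x′ n} {seq y n} {seq y′ n} {B} {δ} {e} 0<B Bδ p q u v)
    (both (λ n p q → p , q) bx by) (both (λ n u v → u , v) (close x≈x′ δ 0<δ) (close y≈y′ δ 0<δ))

+-assoc : ∀ x y z → (x + y) + z ≈ x + (y + z)
+-assoc x y z = pointwise λ n → ℚ.+-assoc (seq x n) (seq y n) (seq z n)

+-comm : ∀ x y → x + y ≈ y + x
+-comm x y = pointwise λ n → ℚ.+-comm (seq x n) (seq y n)

+-identityˡ : ∀ x → 0ℝ + x ≈ x
+-identityˡ x = pointwise λ n → ℚ.+-identityˡ (seq x n)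

+-identityʳ : ∀ x → x + 0ℝ ≈ x
+-identityʳ x = pointwise λ n → ℚ.+-identityʳ (seq x n)

+-inverseˡ : ∀ x → (- x) + x ≈ 0ℝ
+-inverseˡ x = pointwise λ n → ℚ.+-inverseˡ (seq x n)

+-inverseʳ : ∀ x → x + (- x) ≈ 0ℝ
+-inverseʳ x = pointwise λ n → ℚ.+-inverseʳ (seq x n)

*-assoc : ∀ x y z → (x * y) * z ≈ x * (y * z)
*-assoc x y z = pointwise λ n → ℚ.*-assoc (seq x n) (seq y n) (seq z n)

*-comm : ∀ x y → x * y ≈ y * x
*-comm x y = pointwise λ n → ℚ.*-comm (seq x n) (seq y n)

*-identityˡ : ∀ x → 1ℝ * x ≈ x
*-identityˡ x = pointwise λ n → ℚ.*-identityˡ (seq x n)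

*-identityʳ : ∀ x → x * 1ℝ ≈ x
*-identityʳ x = pointwise λ n → ℚ.*-identityʳ (seq x n)

*-distribˡ-+ : ∀ x y z → x * (y + z) ≈ x * y + x * z
*-distribˡ-+ x y z = pointwise λ n → ℚ.*-distribˡ-+ (seq x n) (seq y n) (seq z n)

*-distribʳ-+ : ∀ x y z → (y + z) * x ≈ y * x + z * x
*-distribʳ-+ x y z = pointwise λ n → ℚ.*-distribʳ-+ (seq x n) (seq y n) (seq z n)

ℝ-commutativeRing : CommutativeRing 0ℓ 0ℓ
ℝ-commutativeRing = record
  { Carrier = ℝ
  ; _≈_ = _≈_
  ; _+_ = _+_
  ; _*_ = _*_
  ; -_ = -_
  ; 0# = 0ℝ
  ; 1# = 1ℝ
  ; isCommutativeRing = record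
    { isRing = record
      { +-isAbelianGroup = record
        { isGroup = record
          { isMonoid = record
            { isSemigroup = record
              { isMagma = record
                { isEquivalence = record { refl = ≈-refl ; sym = ≈-sym ; trans = ≈-trans }
                ; ∙-cong = +-cong
                }
              ; assoc = +-assoc
              }
            ; identity = +-identityˡ , +-identityʳ
            }
          ; inverse = +-inverseˡ , +-inverseʳ
          ; ⁻¹-cong = -‿cong
          }
        ; comm = +-comm
        }
      ; *-cong = *-cong
      ; *-assoc = *-assoc
      ; *-identity = *-identityˡ , *-identityʳ
      ; distrib = *-distribˡ-+ , *-distribʳ-+
      }
    ; *-comm = *-comm
    }
  }

√-square : ∀ {x} → 0ℝ ≤ x → √ x * √ x ≈ x
√-square {x} 0≤x = mk≈ λ e 0<e →
  let (B , 0<B , bounds) = bounded (√ x)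
      A = B ℚ.+ B ℚ.+ 1ℚ
      0<A = +-pos {B ℚ.+ B} {1ℚ} (+-pos {B} {B} 0<B 0<B) 0<1
      (δ , 0<δ , Aδ≡e) = divide 0<A 0<e
  in both (λ n (b , small) pos → root-square-estimate {seq x n} {mesh n} {A} {δ} {e}
            (0<mesh n) (mesh≤1 n) 0<A Aδ≡e 0<e (rootApprox (seq x n) n)
            (ℚ.+-monoˡ-≤ 1ℚ (ℚ.+-mono-≤ b b)) small pos)
    (both (λ n p q → p , q) bounds (mesh-small 0<δ)) (below 0≤x e 0<e)

√-nonNeg : ∀ x → 0ℝ ≤ √ x
√-nonNeg x = mk≤ λ e 0<e → 0 , λ n _ →
  ℚ.+-mono-≤-< (RootApprox.root≥0 (rootApprox (seq x n) n)) 0<e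

inv-inverseʳ : ∀ x (x#0 : x # 0ℝ) → x * inv x x#0 ≈ 1ℝ
inv-inverseʳ x x#0 = mk≈ λ e 0<e → let (d , 0<d , N , h) = away-from-0 x x#0 in
  N , λ n N≤n → subst (ℚ._< e)
    (sym (trans (cong (λ z → ℚ.∣ z ℚ.- 1ℚ ∣) (inv₀-inverse {seq x n} (0<∣p∣⇒p≢0 {seq x n} (ℚ.<-≤-trans 0<d (h n N≤n)))))
      (∣p-p∣≡0 1ℚ)))
    0<e

open import Algebra.Properties.Semiring.Exp (CommutativeRing.semiring ℝ-commutativeRing) public using (_^_)

infix 4 _ConvergesTo_ _≈ᴹ_ _≈²_ _#²_ _∈ˢ_
infixl 7 _∙_
infixr 7 _·_

_ConvergesTo_ : (ℕ → ℝ) → ℝ → Set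
x ConvergesTo l = ∀ δ → 0ℝ < δ → Eventually λ n → l - δ < x n × x n < l + δ

-- The matrix with rows (a b) and (c d).
record SL₂ℝ : Set where
  constructor mkSL₂
  field
    a b c d : ℝ
    det≈1   : a * d - b * c ≈ 1ℝ

record _≈ᴹ_ (A B : SL₂ℝ) : Set where
  constructor mk≈ᴹ
  private
    module A = SL₂ℝ A
    module B = SL₂ℝ B
  field
    a≈ : A.a ≈ B.a
    b≈ : A.b ≈ B.b
    c≈ : A.c ≈ B.c
    d≈ : A.d ≈ B.d

_∙_ : SL₂ℝ → SL₂ℝ → SL₂ℝ
mkSL₂ a b c d det ∙ mkSL₂ a′ b′ c′ d′ det′ = mkSL₂
  (a * a′ + b * c′) (a * b′ + b * d′)
  (c * a′ + d * c′) (c * b′ + d * d′)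
  (≈-trans (pointwise λ n → det-* (seq a n) (seq b n) (seq c n) (seq d n) (seq a′ n) (seq b′ n) (seq c′ n) (seq d′ n))
    (≈-trans (*-cong det det′) (*-identityˡ 1ℝ)))

identity : SL₂ℝ
identity = mkSL₂ 1ℝ 0ℝ 0ℝ 1ℝ (pointwise λ _ → refl)

-- For determinant 1 the inverse is the adjugate.
inverse : SL₂ℝ → SL₂ℝ
inverse (mkSL₂ a b c d det) = mkSL₂ d (- b) (- c) a
  (≈-trans (pointwise λ n → det-adj (seq a n) (seq b n) (seq c n) (seq d n)) det)

SL₂ℝ-group : Group 0ℓ 0ℓ
SL₂ℝ-group = record
  { Carrier = SL₂ℝ
  ; _≈_ = _≈ᴹ_
  ; _∙_ = _∙_
  ; ε = identity
  ; _⁻¹ = inverse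
  ; isGroup = record
    { isMonoid = record
      { isSemigroup = record
        { isMagma = record
          { isEquivalence = record
            { refl  = mk≈ᴹ ≈-refl ≈-refl ≈-refl ≈-refl
            ; sym   = λ { (mk≈ᴹ a b c d) → mk≈ᴹ (≈-sym a) (≈-sym b) (≈-sym c) (≈-sym d) }
            ; trans = λ { (mk≈ᴹ a b c d) (mk≈ᴹ p q r s) →
                mk≈ᴹ (≈-trans a p) (≈-trans b q) (≈-trans c r) (≈-trans d s) }
            }
          ; ∙-cong = λ { (mk≈ᴹ a b c d) (mk≈ᴹ p q r s) → mk≈ᴹ
              (+-cong (*-cong a p) (*-cong b r)) (+-cong (*-cong a q) (*-cong b s))
              (+-cong (*-cong c p) (*-cong d r)) (+-cong (*-cong c q) (*-cong d s)) }
          }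
        ; assoc = λ { (mkSL₂ a b c d _) (mkSL₂ p q r s _) (mkSL₂ u v w z _) → record
            { a≈ = row a b p q r s u w
            ; b≈ = row a b p q r s v z
            ; c≈ = row c d p q r s u w
            ; d≈ = row c d p q r s v z
            } }
        }
      ; identity = (λ { (mkSL₂ a b c d _) → record
                      { a≈ = pointwise λ n → unit₁ (seq a n) (seq c n)
                      ; b≈ = pointwise λ n → unit₁ (seq b n) (seq d n)
                      ; c≈ = pointwise λ n → unit₂ (seq a n) (seq c n)
                      ; d≈ = pointwise λ n → unit₂ (seq b n) (seq d n)
                      } })
                 , (λ { (mkSL₂ a b c d _) → record
                      { a≈ = pointwise λ n → unit₃ (seq a n) (seq b n)
                      ; b≈ = pointwise λ n → unit₄ (seq a n) (seq b n)
                      ; c≈ = pointwise λ n → unit₃ (seq c n) (seq d n)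
                      ; d≈ = pointwise λ n → unit₄ (seq c n) (seq d n)
                      } })
      }
    ; inverse = (λ { (mkSL₂ a b c d det) → record
                   { a≈ = ≈-trans (pointwise λ n → det₃ (seq a n) (seq b n) (seq c n) (seq d n)) det
                   ; b≈ = pointwise λ n → vanish₂ (seq d n) (seq b n)
                   ; c≈ = pointwise λ n → vanish₀ (seq a n) (seq c n)
                   ; d≈ = ≈-trans (pointwise λ n → det₄ (seq a n) (seq b n) (seq c n) (seq d n)) det
                   } })
              , (λ { (mkSL₂ a b c d det) → record
                   { a≈ = ≈-trans (pointwise λ n → det₁ (seq a n) (seq b n) (seq c n) (seq d n)) det
                   ; b≈ = pointwise λ n → vanish₁ (seq a n) (seq b n)
                   ; c≈ = pointwise λ n → vanish₃ (seq c n) (seq d n)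
                   ; d≈ = ≈-trans (pointwise λ n → det₂ (seq a n) (seq b n) (seq c n) (seq d n)) det
                   } })
    ; ⁻¹-cong = λ { (mk≈ᴹ a b c d) → mk≈ᴹ d (-‿cong b) (-‿cong c) a }
    }
  }
  where
  row : ∀ a b p q r s u v →
    (a * p + b * r) * u + (a * q + b * s) * v ≈ a * (p * u + q * v) + b * (r * u + s * v)
  row a b p q r s u v = pointwise λ n →
    row-assoc (seq a n) (seq b n) (seq p n) (seq q n) (seq r n) (seq s n) (seq u n) (seq v n)

module _ {c ℓ} (G : Group c ℓ) {I : Set} (generator : I → Group.Carrier G) where
  private module G = Group G

  data Generated : G.Carrier → Set (c Level.⊔ ℓ) where
    gen    : ∀ i → Generated (generator i)
    unit   : Generated G.ε
    mul    : ∀ {g h} → Generated g → Generated h → Generated (g G.∙ h)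
    invert : ∀ {g} → Generated g → Generated (g G.⁻¹)
    resp   : ∀ {g h} → g G.≈ h → Generated g → Generated h

√5 φ : ℝ
√5 = √ (fromℚ (+ 5 ℚ./ 1))
φ  = fromℚ ½ * (1ℝ + √5)

√5-square : √5 * √5 ≈ fromℚ (+ 5 ℚ./ 1)
√5-square = √-square (mk≤ λ e 0<e → 0 , λ _ _ → ℚ.+-mono-< (ℚ.positive⁻¹ (+ 5 ℚ./ 1)) 0<e)

φ-equation : φ * φ - φ ≈ 1ℝ
φ-equation = ≈-trans (pointwise λ n → golden (seq √5 n))
  (≈-trans (+-cong {y = - fromℚ ¼} (*-cong {fromℚ ¼} ≈-refl √5-square) ≈-refl) (pointwise λ _ → refl))

σ : Fin 4 → SL₂ℝ
σ zero                   = mkSL₂ 1ℝ φ 0ℝ 1ℝ (pointwise λ n → det-upper (seq φ n))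
σ (suc zero)             = mkSL₂ φ φ 1ℝ φ
  (≈-trans (+-cong ≈-refl (-‿cong (*-identityʳ φ))) φ-equation)
σ (suc (suc zero))       = mkSL₂ φ 1ℝ φ φ
  (≈-trans (+-cong ≈-refl (-‿cong (*-identityˡ φ))) φ-equation)
σ (suc (suc (suc zero))) = mkSL₂ 1ℝ 0ℝ φ 1ℝ (pointwise λ n → det-lower (seq φ n))

Γ : SL₂ℝ → Set
Γ = Generated SL₂ℝ-group σ

record ℝ² : Set where
  constructor ⟨_,_⟩
  field
    x y : ℝ

record _≈²_ (P Q : ℝ²) : Set where
  field
    x≈ : ℝ².x P ≈ ℝ².x Q
    y≈ : ℝ².y P ≈ ℝ².y Q

_#²_ : ℝ² → ℝ² → Set
P #² Q = ℝ².x P # ℝ².x Q ⊎ ℝ².y P # ℝ².y Q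

_·_ : SL₂ℝ → ℝ² → ℝ²
mkSL₂ a b c d _ · ⟨ x , y ⟩ = ⟨ a * x + b * y , c * x + d * y ⟩

-- The orbit Γ · (1, 0), as a subset of ℝ².
S : ℝ² → Set
S P = ∃ λ γ → Γ γ × P ≈² (γ · ⟨ 1ℝ , 0ℝ ⟩)

origin : ℝ²
origin = ⟨ 0ℝ , 0ℝ ⟩

dist : ℝ² → ℝ² → ℝ
dist ⟨ x , y ⟩ ⟨ x′ , y′ ⟩ = √ ((x - x′) * (x - x′) + (y - y′) * (y - y′))

Ball : ℝ² → ℝ → ℝ² → Set
Ball centre radius P = dist P centre < radius

record HorizontalSegment : Set where
  field
    left right height : ℝ
    left≤right        : left ≤ right

  length : ℝ
  length = right - left

_∈ˢ_ : ℝ² → HorizontalSegment → Set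
⟨ x , y ⟩ ∈ˢ I = left ≤ x × x ≤ right × y ≈ height
  where open HorizontalSegment I

{-# OPTIONS --safe #-}

-- Multiplication by units of ℤ[φ] does not preserve S, and this makes close collinear triples possible.
-- Since φ²ⁿ + φ⁻²ⁿ is an integer, shears by integer multiples of φ and quarter turns reduce the vector
-- (1 , φ^(2n+1)) to φ^(1-2n) (1 , φ^(2n-1)) up to a quarter turn. Hence φ^(n²) (1 , φ^(2n+1)) lies in S.
-- Shears of (0 , 1), (1 , φ) and (2φ² , φ³) give three points of S on a line with this direction whose
-- differences are bounded multiples of (1 , φ^(2n+1)), that is, multiples of size φ^(-n²) of a vector of S.
-- The element of Γ that takes this vector to (1 , 0) makes the line horizontal and the three points lie
-- within ε = φ^(3-n²) of each other. Their coordinates are O(φ^(n²) φ^(6n)) = O(ε⁻⁴).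
module Submission where

open import Defs
open import Algebra.Bundles using (RawRing; CommutativeRing)
open import Algebra.Properties.Semiring.Exp (CommutativeRing.semiring ℝ-commutativeRing) using (^-congˡ)
import Algebra.Solver.Ring as RingSolver
open import Algebra.Solver.Ring.AlmostCommutativeRing using (fromCommutativeRing; _-Raw-AlmostCommutative⟶_; Induced-equivalence)
open import Data.Empty using (⊥-elim)
open import Data.Fin using (zero; suc)
open import Data.Integer using (+_)
open import Data.Maybe.Base using (just; nothing)
open import Data.Nat as ℕ using (ℕ; zero; suc)
import Data.Nat.Properties as ℕ
open import Data.Product using (Σ; ∃; _×_; _,_; proj₁; proj₂)
open import Data.Product.Properties using (≡-dec)
open import Data.Rational as ℚ using (ℚ; 0ℚ; 1ℚ; ½)
import Data.Rational.Properties as ℚ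
open import Data.Rational.Solver using () renaming (module +-*-Solver to ℚS)
open import Data.Sum using (inj₁; inj₂)
open import Level using (0ℓ)
open import Relation.Binary.Definitions using (WeaklyDecidable)
open import Relation.Binary.PropositionalEquality using (_≡_; refl; sym; trans; subst; subst₂; cong)
open import Relation.Nullary using (¬_; yes; no)
open import Relation.Nullary.Decidable using (from-yes)

open ℚ-Lemmas

-- Ring solving over ℝ with coefficients in ℚ(φ).

-- The pair `(a , b)` stands for a + bφ, and products are reduced by φ² = φ + 1. As solver
-- coefficients, these pairs let identities that depend on the golden relation be checked by
-- normalisation.
ℚ[φ] : RawRing 0ℓ 0ℓ
ℚ[φ] = record
  { Carrier = ℚ × ℚ
  ; _≈_ = _≡_
  ; _+_ = λ { (a , b) (c , d) → a ℚ.+ c , b ℚ.+ d }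
  ; _*_ = λ { (a , b) (c , d) → a ℚ.* c ℚ.+ b ℚ.* d , a ℚ.* d ℚ.+ b ℚ.* c ℚ.+ b ℚ.* d }
  ; -_  = λ { (a , b) → ℚ.- a , ℚ.- b }
  ; 0#  = 0ℚ , 0ℚ
  ; 1#  = 1ℚ , 0ℚ
  }

-- The case distinction makes embed (q , 0) and embed (0 , 1) reduce to fromℚ q and φ,
-- so that solver equations match goals written with these terms.
embed : ℚ × ℚ → ℝ
embed (a , b) with b ℚ.≟ 0ℚ
... | yes _ = fromℚ a
... | no _ with a ℚ.≟ 0ℚ | b ℚ.≟ 1ℚ
...   | yes _ | yes _ = φ
...   | yes _ | no _  = fromℚ a + fromℚ b * φ
...   | no _  | _     = fromℚ a + fromℚ b * φ

embed-≈ : ∀ a b → embed (a , b) ≈ fromℚ a + fromℚ b * φ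
embed-≈ a b with b ℚ.≟ 0ℚ
... | yes refl = pointwise λ n → solve 2 (λ a t → a := a :+ con 0ℚ :* t) refl a (seq φ n)
  where open ℚS
... | no _ with a ℚ.≟ 0ℚ | b ℚ.≟ 1ℚ
...   | yes refl | yes refl = pointwise λ n → solve 1 (λ t → t := con 0ℚ :+ con 1ℚ :* t) refl (seq φ n)
  where open ℚS
...   | yes _ | no _  = ≈-refl
...   | no _  | _     = ≈-refl

φ*φ≈φ+1 : φ * φ ≈ φ + 1ℝ
φ*φ≈φ+1 = ≈-trans (pointwise λ n → solve 1 (λ t → t :* t := t :+ (t :* t :- t)) refl (seq φ n))
  (+-cong ≈-refl φ-equation)
  where open ℚS

embed-homomorphism : ℚ[φ] -Raw-AlmostCommutative⟶ fromCommutativeRing ℝ-commutativeRing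
embed-homomorphism = record
  { ⟦_⟧    = embed
  ; +-homo = λ { (a , b) (c , d) → ≈-trans (embed-≈ (a ℚ.+ c) (b ℚ.+ d)) (≈-trans
      (pointwise λ n → solve 5 (λ a b c d t → a :+ c :+ (b :+ d) :* t := a :+ b :* t :+ (c :+ d :* t)) refl a b c d (seq φ n))
      (≈-sym (+-cong (embed-≈ a b) (embed-≈ c d)))) }
  ; *-homo = λ { (a , b) (c , d) → ≈-trans (embed-≈ (a ℚ.* c ℚ.+ b ℚ.* d) (a ℚ.* d ℚ.+ b ℚ.* c ℚ.+ b ℚ.* d)) (≈-trans
      (pointwise λ n → solve 5 (λ a b c d t → a :* c :+ b :* d :+ (a :* d :+ b :* c :+ b :* d) :* t
        := a :* c :+ (a :* d :+ b :* c) :* t :+ b :* d :* (t :+ con 1ℚ)) refl a b c d (seq φ n))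
      -- The only use of φ² = φ + 1: the factor φ + 1 is folded back into φ². The remaining steps
      -- are termwise polynomial identities.
      (≈-trans (+-cong {fromℚ (a ℚ.* c) + fromℚ (a ℚ.* d ℚ.+ b ℚ.* c) * φ} ≈-refl
        (*-cong {fromℚ (b ℚ.* d)} ≈-refl (≈-sym φ*φ≈φ+1)))
      (≈-trans (pointwise λ n → solve 5 (λ a b c d t → a :* c :+ (a :* d :+ b :* c) :* t :+ b :* d :* (t :* t)
        := (a :+ b :* t) :* (c :+ d :* t)) refl a b c d (seq φ n))
      (≈-sym (*-cong (embed-≈ a b) (embed-≈ c d)))))) }
  ; -‿homo = λ { (a , b) → ≈-trans (embed-≈ (ℚ.- a) (ℚ.- b)) (≈-trans
      (pointwise λ n → solve 3 (λ a b t → :- a :+ :- b :* t := :- (a :+ b :* t)) refl a b (seq φ n))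
      (-‿cong (≈-sym (embed-≈ a b)))) }
  ; 0-homo = ≈-refl
  ; 1-homo = ≈-refl
  }
  where open ℚS

embed-≟ : WeaklyDecidable (Induced-equivalence embed-homomorphism)
embed-≟ c d with ≡-dec ℚ._≟_ ℚ._≟_ c d
... | yes refl = just ≈-refl
... | no _     = nothing

module φ-Solver = RingSolver ℚ[φ] (fromCommutativeRing ℝ-commutativeRing) embed-homomorphism embed-≟
open φ-Solver using (Polynomial; solve; con; _:+_; _:*_; _:-_; :-_; _:=_)

:φ :ψ :0 :1 : ∀ {n} → Polynomial n
:φ = con (0ℚ , 1ℚ)
:ψ = :φ :- :1
:0 = con (0ℚ , 0ℚ)
:1 = con (1ℚ , 0ℚ)

-- This is φ⁻¹, and `- ψ` is the Galois conjugate of φ.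
ψ : ℝ
ψ = φ - 1ℝ

-- The order on the reals.

halves : ∀ x e → x ℚ.+ e ℚ.* ½ ℚ.+ e ℚ.* ½ ≡ x ℚ.+ e
halves = ℚS.solve 2 (λ x e → x ℚS.:+ e ℚS.:* ℚS.con ½ ℚS.:+ e ℚS.:* ℚS.con ½ ℚS.:= x ℚS.:+ e) refl

≈⇒≤ : ∀ {x y} → x ≈ y → x ≤ y
≈⇒≤ {x} {y} x≈y = mk≤ λ e 0<e → let (N , h) = close x≈y e 0<e in
  N , λ n N≤n → p<q+e {seq x n} {seq y n} {e} (h n N≤n)

≤-refl : ∀ {x} → x ≤ x
≤-refl = ≈⇒≤ ≈-refl

≤-trans : ∀ {x y z} → x ≤ y → y ≤ z → x ≤ z
≤-trans {x} {y} {z} x≤y y≤z = mk≤ λ e 0<e → both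
  (λ n p q → ℚ.<-trans p (subst (seq y n ℚ.+ e ℚ.* ½ ℚ.<_) (halves (seq z n) e) (ℚ.+-monoˡ-< (e ℚ.* ½) q)))
  (below x≤y (e ℚ.* ½) (half-pos 0<e)) (below y≤z (e ℚ.* ½) (half-pos 0<e))

≤-resp-≈ : ∀ {x x′ y y′} → x ≈ x′ → y ≈ y′ → x ≤ y → x′ ≤ y′
≤-resp-≈ x≈x′ y≈y′ x≤y = ≤-trans (≈⇒≤ (≈-sym x≈x′)) (≤-trans x≤y (≈⇒≤ y≈y′))

<⇒≤ : ∀ {x y} → x < y → x ≤ y
<⇒≤ {x} {y} (mk< gap 0<gap (N , h)) = mk≤ λ e 0<e → N , λ n N≤n → ℚ.≤-<-trans
  (ℚ.≤-trans (p≤p+q (seq x n) 0<gap) (h n N≤n))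
  (subst (ℚ._< seq y n ℚ.+ e) (ℚ.+-identityʳ (seq y n)) (ℚ.+-monoʳ-< (seq y n) 0<e))

≤-<-trans : ∀ {x y z} → x ≤ y → y < z → x < z
≤-<-trans {x} {y} {z} x≤y (mk< gap 0<gap y<z) = mk< (gap ℚ.* ½) (half-pos 0<gap) (both
  (λ n p q → ℚ.≤-trans (ℚ.+-monoˡ-≤ (gap ℚ.* ½) (ℚ.<⇒≤ p))
    (subst (ℚ._≤ seq z n) (sym (halves (seq y n) gap)) q))
  (below x≤y (gap ℚ.* ½) (half-pos 0<gap)) y<z)

<-≤-trans : ∀ {x y z} → x < y → y ≤ z → x < z
<-≤-trans {x} {y} {z} (mk< gap 0<gap x<y) y≤z = mk< (gap ℚ.* ½) (half-pos 0<gap) (both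
  (λ n p q → cancel (seq x n) (seq z n) (ℚ.≤-trans p (ℚ.<⇒≤ q)))
  x<y (below y≤z (gap ℚ.* ½) (half-pos 0<gap)))
  where
  cancel : ∀ a b → a ℚ.+ gap ℚ.≤ b ℚ.+ gap ℚ.* ½ → a ℚ.+ gap ℚ.* ½ ℚ.≤ b
  cancel a b h = subst₂ ℚ._≤_
    (ℚS.solve 2 (λ a g → a ℚS.:+ g ℚS.:+ ℚS.:- (g ℚS.:* ℚS.con ½) ℚS.:= a ℚS.:+ g ℚS.:* ℚS.con ½) refl a gap)
    (ℚS.solve 2 (λ b g → b ℚS.:+ g ℚS.:* ℚS.con ½ ℚS.:+ ℚS.:- (g ℚS.:* ℚS.con ½) ℚS.:= b) refl b gap)
    (ℚ.+-monoˡ-≤ (ℚ.- (gap ℚ.* ½)) h)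

<-resp-≈ : ∀ {x x′ y y′} → x ≈ x′ → y ≈ y′ → x < y → x′ < y′
<-resp-≈ x≈x′ y≈y′ x<y = ≤-<-trans (≈⇒≤ (≈-sym x≈x′)) (<-≤-trans x<y (≈⇒≤ y≈y′))

<-irrefl : ∀ {x} → ¬ x < x
<-irrefl {x} (mk< gap 0<gap (N , h)) = ℚ-Lemmas.<⇒≱
  (subst (ℚ._< seq x N ℚ.+ gap) (ℚ.+-identityʳ (seq x N)) (ℚ.+-monoʳ-< (seq x N) 0<gap))
  (h N ℕ.≤-refl)

-- One rational comparison at a late index decides: either `y` stays below `x + e` from there on, or
-- `x < y` with gap e/2, which is excluded.
≮⇒≥ : ∀ {x y} → ¬ x < y → y ≤ x
≮⇒≥ {x} {y} x≮y = mk≤ bound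
  where
  bound : ∀ e → 0ℚ ℚ.< e → Eventually λ n → seq y n ℚ.< seq x n ℚ.+ e
  bound e 0<e = decide (isCauchy x δ 0<δ) (isCauchy y δ 0<δ)
    where
    -- With δ = e/8 and t = 3e/4, two fluctuations of size δ give t + 2δ = e on one side and t - 2δ
    -- = e/2 on the other.
    δ = e ℚ.* ½ ℚ.* ½ ℚ.* ½
    t = e ℚ.- (δ ℚ.+ δ)
    0<δ : 0ℚ ℚ.< δ
    0<δ = half-pos (half-pos (half-pos 0<e))
    upper : ∀ {a a′ b b′} → b′ ℚ.< b ℚ.+ δ → b ℚ.< a ℚ.+ t → a ℚ.< a′ ℚ.+ δ → b′ ℚ.< a′ ℚ.+ e
    upper {a} {a′} {b} {b′} b′<b b<a a<a′ = subst (b′ ℚ.<_)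
      (ℚS.solve 3 (λ a e δ → a ℚS.:+ δ ℚS.:+ (e ℚS.:- (δ ℚS.:+ δ)) ℚS.:+ δ ℚS.:= a ℚS.:+ e) refl a′ e δ)
      (ℚ.<-trans b′<b (ℚ.+-monoˡ-< δ (ℚ.<-trans b<a (ℚ.+-monoˡ-< t a<a′))))
    lower : ∀ {a a′ b b′} → a′ ℚ.< a ℚ.+ δ → a ℚ.+ t ℚ.≤ b → b ℚ.< b′ ℚ.+ δ → a′ ℚ.+ e ℚ.* ½ ℚ.≤ b′
    lower {a} {a′} {b} {b′} a′<a a≤b b<b′ = subst₂ ℚ._≤_
      (ℚS.solve 2 (λ a e → let δ = e ℚS.:* ℚS.con ½ ℚS.:* ℚS.con ½ ℚS.:* ℚS.con ½ in
        a ℚS.:+ ((e ℚS.:- (δ ℚS.:+ δ)) ℚS.:- δ) ℚS.:- δ ℚS.:= a ℚS.:+ e ℚS.:* ℚS.con ½) refl a′ e)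
      (ℚS.solve 2 (λ b δ → b ℚS.:+ δ ℚS.:- δ ℚS.:= b) refl b′ δ)
      (ℚ.+-monoˡ-≤ (ℚ.- δ) (ℚ.≤-trans
        (subst (a′ ℚ.+ (t ℚ.- δ) ℚ.≤_)
          (ℚS.solve 3 (λ a t δ → a ℚS.:+ δ ℚS.:+ (t ℚS.:- δ) ℚS.:= a ℚS.:+ t) refl a t δ)
          (ℚ.+-monoˡ-≤ (t ℚ.- δ) (ℚ.<⇒≤ a′<a)))
        (ℚ.≤-trans a≤b (ℚ.<⇒≤ b<b′))))
    decide : (∃ λ M → ∀ m n → M ℕ.≤ m → M ℕ.≤ n → ℚ.∣ seq x m ℚ.- seq x n ∣ ℚ.< δ) →
             (∃ λ N → ∀ m n → N ℕ.≤ m → N ℕ.≤ n → ℚ.∣ seq y m ℚ.- seq y n ∣ ℚ.< δ) →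
             Eventually λ n → seq y n ℚ.< seq x n ℚ.+ e
    decide (M , p) (N , q) with seq y (M ℕ.⊔ N) ℚ.<? seq x (M ℕ.⊔ N) ℚ.+ t
    ... | yes y<x = M ℕ.⊔ N , λ n K≤n → upper {seq x (M ℕ.⊔ N)} {seq x n} {seq y (M ℕ.⊔ N)} {seq y n}
      (p<q+e {seq y n} (q n (M ℕ.⊔ N) (ℕ.≤-trans (ℕ.m≤n⊔m M N) K≤n) (ℕ.m≤n⊔m M N))) y<x
      (p<q+e {seq x (M ℕ.⊔ N)} (p (M ℕ.⊔ N) n (ℕ.m≤m⊔n M N) (ℕ.≤-trans (ℕ.m≤m⊔n M N) K≤n)))
    ... | no y≮x = ⊥-elim (x≮y (mk< (e ℚ.* ½) (half-pos 0<e) (M ℕ.⊔ N , λ n K≤n →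
      lower {seq x (M ℕ.⊔ N)} {seq x n} {seq y (M ℕ.⊔ N)} {seq y n}
      (p<q+e {seq x n} (p n (M ℕ.⊔ N) (ℕ.≤-trans (ℕ.m≤m⊔n M N) K≤n) (ℕ.m≤m⊔n M N))) (ℚ.≮⇒≥ y≮x)
      (p<q+e {seq y (M ℕ.⊔ N)} (q (M ℕ.⊔ N) n (ℕ.m≤n⊔m M N) (ℕ.≤-trans (ℕ.m≤n⊔m M N) K≤n))))))

+-mono-≤ : ∀ {x x′ y y′} → x ≤ x′ → y ≤ y′ → x + y ≤ x′ + y′
+-mono-≤ {x} {x′} {y} {y′} x≤x′ y≤y′ = mk≤ λ e 0<e → both
  (λ n p q → subst (seq x n ℚ.+ seq y n ℚ.<_)
    (ℚS.solve 3 (λ a b e → a ℚS.:+ e ℚS.:* ℚS.con ½ ℚS.:+ (b ℚS.:+ e ℚS.:* ℚS.con ½) ℚS.:= a ℚS.:+ b ℚS.:+ e)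
      refl (seq x′ n) (seq y′ n) e)
    (ℚ.+-mono-< p q))
  (below x≤x′ (e ℚ.* ½) (half-pos 0<e)) (below y≤y′ (e ℚ.* ½) (half-pos 0<e))

0≤y-x : ∀ {x y} → x ≤ y → 0ℝ ≤ y - x
0≤y-x {x} {y} x≤y = ≤-resp-≈ (+-inverseʳ x) ≈-refl (+-mono-≤ x≤y ≤-refl)

0≤y-x⇒x≤y : ∀ {x y} → 0ℝ ≤ y - x → x ≤ y
0≤y-x⇒x≤y {x} {y} 0≤y-x = ≤-resp-≈ (+-identityˡ x)
  (solve 2 (λ x y → y :- x :+ x := y) ≈-refl x y) (+-mono-≤ 0≤y-x ≤-refl)

0≤+ : ∀ {x y} → 0ℝ ≤ x → 0ℝ ≤ y → 0ℝ ≤ x + y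
0≤+ 0≤x 0≤y = ≤-resp-≈ (+-identityˡ 0ℝ) ≈-refl (+-mono-≤ 0≤x 0≤y)

0≤square : ∀ x → 0ℝ ≤ x * x
0≤square x = mk≤ λ e 0<e → 0 , λ n _ → ℚ.+-mono-≤-< (nonNeg (seq x n)) 0<e
  where
  nonNeg : ∀ q → 0ℚ ℚ.≤ q ℚ.* q
  nonNeg q with ℚ.≤-total 0ℚ q
  ... | inj₁ 0≤q = *-nonNeg 0≤q 0≤q
  ... | inj₂ q≤0 = subst (0ℚ ℚ.≤_) (ℚS.solve 1 (λ q → ℚS.:- q ℚS.:* ℚS.:- q ℚS.:= q ℚS.:* q) refl q)
    (*-nonNeg {ℚ.- q} {ℚ.- q} (ℚ.neg-antimono-≤ q≤0) (ℚ.neg-antimono-≤ q≤0))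

-- Nonnegative reals are squares, which reduces the claim to 0≤square.
0≤* : ∀ {x y} → 0ℝ ≤ x → 0ℝ ≤ y → 0ℝ ≤ x * y
0≤* {x} {y} 0≤x 0≤y = ≤-resp-≈ ≈-refl
  (≈-trans (solve 2 (λ a b → a :* b :* (a :* b) := a :* a :* (b :* b)) ≈-refl (√ x) (√ y))
    (*-cong (√-square 0≤x) (√-square 0≤y)))
  (0≤square (√ x * √ y))

*-mono-≤ : ∀ {x x′ y y′} → 0ℝ ≤ x → 0ℝ ≤ y′ → x ≤ x′ → y ≤ y′ → x * y ≤ x′ * y′
*-mono-≤ {x} {x′} {y} {y′} 0≤x 0≤y′ x≤x′ y≤y′ = 0≤y-x⇒x≤y (≤-resp-≈ ≈-refl
  (solve 4 (λ x x′ y y′ → x :* (y′ :- y) :+ (x′ :- x) :* y′ := x′ :* y′ :- x :* y) ≈-refl x x′ y y′)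
  (0≤+ (0≤* 0≤x (0≤y-x y≤y′)) (0≤* (0≤y-x x≤x′) 0≤y′)))

0<* : ∀ {x y} → 0ℝ < x → 0ℝ < y → 0ℝ < x * y
0<* {x} {y} (mk< g 0<g p) (mk< h 0<h q) = mk< (g ℚ.* h) (*-pos 0<g 0<h) (both
  (λ n u v → subst (ℚ._≤ seq x n ℚ.* seq y n) (sym (ℚ.+-identityˡ (g ℚ.* h)))
    (ℚ-Lemmas.*-mono (ℚ.<⇒≤ 0<g) (ℚ.≤-trans (ℚ.<⇒≤ 0<h) (drop v)) (drop u) (drop v)))
  p q)
  where
  drop : ∀ {a b} → 0ℚ ℚ.+ a ℚ.≤ b → a ℚ.≤ b
  drop {a} {b} = subst (ℚ._≤ b) (ℚ.+-identityˡ a)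

fromℚ-mono-< : ∀ {p q} → p ℚ.< q → fromℚ p < fromℚ q
fromℚ-mono-< {p} {q} p<q = mk< (q ℚ.- p)
  (subst (ℚ._< q ℚ.- p) (ℚ.+-inverseʳ p) (ℚ.+-monoˡ-< (ℚ.- p) p<q))
  (0 , λ _ _ → ℚ.≤-reflexive (ℚS.solve 2 (λ p q → p ℚS.:+ (q ℚS.:- p) ℚS.:= q) refl p q))

fromℚ-mono-≤ : ∀ {p q} → p ℚ.≤ q → fromℚ p ≤ fromℚ q
fromℚ-mono-≤ {p} {q} p≤q = mk≤ λ e 0<e → 0 , λ _ _ →
  subst (ℚ._< q ℚ.+ e) (ℚ.+-identityʳ p) (ℚ.+-mono-≤-< p≤q 0<e)

+-monoʳ-< : ∀ x {y z} → y < z → x + y < x + z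
+-monoʳ-< x {y} {z} (mk< gap 0<gap (N , h)) = mk< gap 0<gap (N , λ n N≤n →
  subst (ℚ._≤ seq x n ℚ.+ seq z n) (sym (ℚ.+-assoc (seq x n) (seq y n) gap)) (ℚ.+-monoʳ-≤ (seq x n) (h n N≤n)))

*-monoʳ-< : ∀ {x y z} → 0ℝ < x → y < z → x * y < x * z
*-monoʳ-< {x} {y} {z} 0<x y<z = <-resp-≈ (+-identityʳ (x * y))
  (solve 3 (λ x y z → x :* y :+ x :* (:- y :+ z) := x :* z) ≈-refl x y z)
  (+-monoʳ-< (x * y) (0<* 0<x (<-resp-≈ (+-inverseˡ y) ≈-refl (+-monoʳ-< (- y) y<z))))

-- If y < x, then yy ≤ xy < xx, against the hypothesis; `≮⇒≥` turns this refutation into the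
-- inequality.
square-cancel-≤ : ∀ {x y} → 0ℝ ≤ y → x * x ≤ y * y → x ≤ y
square-cancel-≤ {x} {y} 0≤y xx≤yy = ≮⇒≥ λ y<x → <-irrefl (≤-<-trans xx≤yy
  (≤-<-trans (*-mono-≤ 0≤y 0≤y (<⇒≤ y<x) ≤-refl)
    (*-monoʳ-< (≤-<-trans 0≤y y<x) y<x)))

-- Bounds on absolute values and membership in balls.

record ∣_∣≤_ (x M : ℝ) : Set where
  constructor _,_
  field
    lower : - M ≤ x
    upper : x ≤ M

0≤⇒∣∣≤ : ∀ {x M} → 0ℝ ≤ x → x ≤ M → ∣ x ∣≤ M
0≤⇒∣∣≤ {x} {M} 0≤x x≤M = 0≤y-x⇒x≤y (≤-resp-≈ ≈-refl
  (solve 2 (λ x M → x :+ M := x :- :- M) ≈-refl x M) (0≤+ 0≤x (≤-trans 0≤x x≤M))) , x≤M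

∣∣≤-weaken : ∀ {x M N} → ∣ x ∣≤ M → M ≤ N → ∣ x ∣≤ N
∣∣≤-weaken {x} {M} {N} (l , u) M≤N = ≤-trans (0≤y-x⇒x≤y (≤-resp-≈ ≈-refl
  (solve 2 (λ M N → N :- M := :- M :- :- N) ≈-refl M N) (0≤y-x M≤N))) l , ≤-trans u M≤N

∣-∣≤ : ∀ {x M} → ∣ x ∣≤ M → ∣ - x ∣≤ M
∣-∣≤ {x} {M} (l , u) =
  0≤y-x⇒x≤y (≤-resp-≈ ≈-refl (solve 2 (λ x M → M :- x := :- x :- :- M) ≈-refl x M) (0≤y-x u)) ,
  0≤y-x⇒x≤y (≤-resp-≈ ≈-refl (solve 2 (λ x M → x :- :- M := M :- :- x) ≈-refl x M) (0≤y-x l))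

∣+∣≤ : ∀ {x y M N} → ∣ x ∣≤ M → ∣ y ∣≤ N → ∣ x + y ∣≤ (M + N)
∣+∣≤ {M = M} {N} (l , u) (l′ , u′) = ≤-resp-≈
  (solve 2 (λ M N → :- M :+ :- N := :- (M :+ N)) ≈-refl M N) ≈-refl (+-mono-≤ l l′) , +-mono-≤ u u′

-- 2 (M N - x y) = (M - x) (N + y) + (M + x) (N - y), and likewise for M N + x y.
∣*∣≤ : ∀ {x y M N} → ∣ x ∣≤ M → ∣ y ∣≤ N → ∣ x * y ∣≤ (M * N)
∣*∣≤ {x} {y} {M} {N} (l , u) (l′ , u′) =
  0≤y-x⇒x≤y (≤-resp-≈ ≈-refl
    (solve 4 (λ x y M N → con (½ , 0ℚ) :* ((M :- x) :* (N :- y) :+ (x :- :- M) :* (y :- :- N))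
      := x :* y :- :- (M :* N)) ≈-refl x y M N)
    (0≤* 0≤½ (0≤+ (0≤* (0≤y-x u) (0≤y-x u′)) (0≤* (0≤y-x l) (0≤y-x l′))))) ,
  0≤y-x⇒x≤y (≤-resp-≈ ≈-refl
    (solve 4 (λ x y M N → con (½ , 0ℚ) :* ((M :- x) :* (y :- :- N) :+ (x :- :- M) :* (N :- y))
      := M :* N :- x :* y) ≈-refl x y M N)
    (0≤* 0≤½ (0≤+ (0≤* (0≤y-x u) (0≤y-x l′)) (0≤* (0≤y-x l) (0≤y-x u′)))))
  where
  0≤½ : 0ℝ ≤ fromℚ ½
  0≤½ = fromℚ-mono-≤ (ℚ.<⇒≤ (ℚ.positive⁻¹ ½))

2ℝ : ℝ
2ℝ = 1ℝ + 1ℝ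

-- The norm is at most √2 M, and 3/2 is a rational number between √2 and 2, which makes the bound
-- strict.
square∈Ball : ∀ {x y M} → 0ℝ < M → ∣ x ∣≤ M → ∣ y ∣≤ M → Ball origin (2ℝ * M) ⟨ x , y ⟩
square∈Ball {x} {y} {M} 0<M (lx , ux) (ly , uy) = ≤-<-trans
  (square-cancel-≤ {y = fromℚ (+ 3 ℚ./ 2) * M} (0≤* 0≤3/2 (<⇒≤ 0<M)) (≤-trans (≈⇒≤ (√-square 0≤z)) z≤))
  (<-resp-≈ (solve 1 (λ M → M :* con (+ 3 ℚ./ 2 , 0ℚ) := con (+ 3 ℚ./ 2 , 0ℚ) :* M) ≈-refl M)
    (solve 1 (λ M → M :* con (+ 2 ℚ./ 1 , 0ℚ) := (:1 :+ :1) :* M) ≈-refl M)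
    (*-monoʳ-< 0<M (fromℚ-mono-< 3/2<2)))
  where
  0≤3/2 : 0ℝ ≤ fromℚ (+ 3 ℚ./ 2)
  0≤3/2 = fromℚ-mono-≤ (ℚ.<⇒≤ (ℚ.positive⁻¹ (+ 3 ℚ./ 2)))
  3/2<2 : + 3 ℚ./ 2 ℚ.< + 2 ℚ./ 1
  3/2<2 = from-yes (+ 3 ℚ./ 2 ℚ.<? + 2 ℚ./ 1)
  z = (x - 0ℝ) * (x - 0ℝ) + (y - 0ℝ) * (y - 0ℝ)
  0≤z : 0ℝ ≤ z
  0≤z = 0≤+ (0≤square (x - 0ℝ)) (0≤square (y - 0ℝ))
  z≤ : z ≤ fromℚ (+ 3 ℚ./ 2) * M * (fromℚ (+ 3 ℚ./ 2) * M)
  -- The difference is (M² - x²) + (M² - y²) + M²/4.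
  z≤ = 0≤y-x⇒x≤y (≤-resp-≈ ≈-refl
    (solve 3 (λ x y M → (M :- x) :* (x :- :- M) :+ (M :- y) :* (y :- :- M) :+ con (½ , 0ℚ) :* con (½ , 0ℚ) :* (M :* M)
      := con (+ 3 ℚ./ 2 , 0ℚ) :* M :* (con (+ 3 ℚ./ 2 , 0ℚ) :* M)
        :- ((x :- :0) :* (x :- :0) :+ (y :- :0) :* (y :- :0))) ≈-refl x y M)
    (0≤+ (0≤+ (0≤* (0≤y-x ux) (0≤y-x lx)) (0≤* (0≤y-x uy) (0≤y-x ly)))
      (0≤* (0≤square (fromℚ ½)) (0≤square M))))

-- Positivity of φ and its inverse.

0≤φ : 0ℝ ≤ φ
0≤φ = 0≤* (fromℚ-mono-≤ (ℚ.<⇒≤ (ℚ.positive⁻¹ ½))) (0≤+ (fromℚ-mono-≤ (ℚ.<⇒≤ (ℚ.positive⁻¹ 1ℚ))) (√-nonNeg _))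

-- Since φψ = 1, ψ equals φψ², a product of nonnegative factors.
0≤ψ : 0ℝ ≤ ψ
0≤ψ = ≤-resp-≈ ≈-refl (solve 0 (:φ :* (:ψ :* :ψ) := :ψ) ≈-refl) (0≤* 0≤φ (0≤square ψ))

1≤φ : 1ℝ ≤ φ
1≤φ = 0≤y-x⇒x≤y 0≤ψ

-- From ψ³ = 2ψ - 1 ≥ 0 follows ψ ≥ ½.
0<ψ : 0ℝ < ψ
0<ψ = <-≤-trans (fromℚ-mono-< (ℚ.positive⁻¹ ½)) (0≤y-x⇒x≤y (≤-resp-≈ ≈-refl
  (solve 0 (con (½ , 0ℚ) :* (:ψ :* (:ψ :* :ψ)) := :ψ :- con (½ , 0ℚ)) ≈-refl)
  (0≤* (fromℚ-mono-≤ (ℚ.<⇒≤ (ℚ.positive⁻¹ ½))) (0≤* 0≤ψ (0≤square ψ)))))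

0<1ℝ : 0ℝ < 1ℝ
0<1ℝ = fromℚ-mono-< (ℚ.positive⁻¹ 1ℚ)

0<φ : 0ℝ < φ
0<φ = <-≤-trans 0<1ℝ 1≤φ

-- Elements of Γ and their action on S.

-- The additive group generated by 1. Its constructors mirror unit, generator, product and inverse
-- in Γ, so `Γ-shear` is a recursion on them that yields the powers of σ₀.
data IsInteger : ℝ → Set where
  int-0   : IsInteger 0ℝ
  int-1   : IsInteger 1ℝ
  int-+   : ∀ {x y} → IsInteger x → IsInteger y → IsInteger (x + y)
  int-neg : ∀ {x} → IsInteger x → IsInteger (- x)

Γ[_,_,_,_] : ℝ → ℝ → ℝ → ℝ → Set
Γ[ a , b , c , d ] = Σ (a * d - b * c ≈ 1ℝ) λ det → Γ (mkSL₂ a b c d det)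

Γ-resp : ∀ {a b c d a′ b′ c′ d′} → a ≈ a′ → b ≈ b′ → c ≈ c′ → d ≈ d′ →
  Γ[ a , b , c , d ] → Γ[ a′ , b′ , c′ , d′ ]
Γ-resp a≈ b≈ c≈ d≈ (det , γ∈Γ) =
  ≈-trans (≈-sym (+-cong (*-cong a≈ d≈) (-‿cong (*-cong b≈ c≈)))) det , resp (mk≈ᴹ a≈ b≈ c≈ d≈) γ∈Γ

Γ-mul : ∀ {a b c d a′ b′ c′ d′} → Γ[ a , b , c , d ] → Γ[ a′ , b′ , c′ , d′ ] →
  Γ[ a * a′ + b * c′ , a * b′ + b * d′ , c * a′ + d * c′ , c * b′ + d * d′ ]
Γ-mul (_ , γ∈Γ) (_ , γ′∈Γ) = _ , mul γ∈Γ γ′∈Γ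

Γ-inverse : ∀ {a b c d} → Γ[ a , b , c , d ] → Γ[ d , - b , - c , a ]
Γ-inverse (_ , γ∈Γ) = _ , invert γ∈Γ

Γ-shear : ∀ {z} → IsInteger z → Γ[ 1ℝ , z * φ , 0ℝ , 1ℝ ]
Γ-shear int-0 = Γ-resp ≈-refl (solve 0 (:0 := :0 :* :φ) ≈-refl) ≈-refl ≈-refl (_ , unit)
Γ-shear int-1 = Γ-resp ≈-refl (solve 0 (:φ := :1 :* :φ) ≈-refl) ≈-refl ≈-refl (_ , gen zero)
Γ-shear (int-+ {x} {y} ix iy) = Γ-resp
  (solve 1 (λ x → :1 :* :1 :+ x :* :φ :* :0 := :1) ≈-refl x)
  (solve 2 (λ x y → :1 :* (y :* :φ) :+ x :* :φ :* :1 := (x :+ y) :* :φ) ≈-refl x y)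
  (solve 0 (:0 :* :1 :+ :1 :* :0 := :0) ≈-refl)
  (solve 1 (λ y → :0 :* (y :* :φ) :+ :1 :* :1 := :1) ≈-refl y)
  (Γ-mul (Γ-shear ix) (Γ-shear iy))
Γ-shear (int-neg {x} ix) = Γ-resp
  ≈-refl (solve 1 (λ x → :- (x :* :φ) := :- x :* :φ) ≈-refl x) (solve 0 (:- :0 := :0) ≈-refl) ≈-refl
  (Γ-inverse (Γ-shear ix))

-- The quarter turn is σ₀⁻¹ σ₁ σ₀⁻¹.
Γ-rotation : Γ[ 0ℝ , - 1ℝ , 1ℝ , 0ℝ ]
Γ-rotation = Γ-resp
  (solve 0 ((:1 :* :φ :+ :- :φ :* :1) :* :1 :+ (:1 :* :φ :+ :- :φ :* :φ) :* :- :0 := :0) ≈-refl)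
  (solve 0 ((:1 :* :φ :+ :- :φ :* :1) :* :- :φ :+ (:1 :* :φ :+ :- :φ :* :φ) :* :1 := :- :1) ≈-refl)
  (solve 0 ((:- :0 :* :φ :+ :1 :* :1) :* :1 :+ (:- :0 :* :φ :+ :1 :* :φ) :* :- :0 := :1) ≈-refl)
  (solve 0 ((:- :0 :* :φ :+ :1 :* :1) :* :- :φ :+ (:- :0 :* :φ :+ :1 :* :φ) :* :1 := :0) ≈-refl)
  (Γ-mul (Γ-mul (Γ-inverse (_ , gen zero)) (_ , gen (suc zero))) (Γ-inverse (_ , gen zero)))

-- The inverse rotation followed by the lower shear (1 0; z φ 1).
Γ-shear-rotation : ∀ {z} → IsInteger z → Γ[ 0ℝ , 1ℝ , - 1ℝ , z * φ ]
Γ-shear-rotation {z} iz = Γ-resp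
  (solve 1 (λ z → :0 :* :1 :+ :- (:- :1) :* :0 := :0) ≈-refl z)
  (solve 1 (λ z → :0 :* (:- z :* :φ) :+ :- (:- :1) :* :1 := :1) ≈-refl z)
  (solve 1 (λ z → :- :1 :* :1 :+ :0 :* :0 := :- :1) ≈-refl z)
  (solve 1 (λ z → :- :1 :* (:- z :* :φ) :+ :0 :* :1 := z :* :φ) ≈-refl z)
  (Γ-mul (Γ-inverse Γ-rotation) (Γ-shear (int-neg iz)))

S-resp : ∀ {P Q} → P ≈² Q → S P → S Q
S-resp P≈Q (γ , γ∈Γ , P≈γe₁) = γ , γ∈Γ , record
  { x≈ = ≈-trans (≈-sym (_≈²_.x≈ P≈Q)) (_≈²_.x≈ P≈γe₁)
  ; y≈ = ≈-trans (≈-sym (_≈²_.y≈ P≈Q)) (_≈²_.y≈ P≈γe₁)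
  }

S-column : ∀ {a b c d} → Γ[ a , b , c , d ] → S ⟨ a , c ⟩
S-column {a} {b} {c} {d} (_ , γ∈Γ) = _ , γ∈Γ , record
  { x≈ = column a b
  ; y≈ = column c d
  }
  where
  column : ∀ a b → a ≈ a * 1ℝ + b * 0ℝ
  column = solve 2 (λ a b → a := a :* :1 :+ b :* :0) ≈-refl

S-act : ∀ {a b c d x y} → Γ[ a , b , c , d ] → S ⟨ x , y ⟩ → S ⟨ a * x + b * y , c * x + d * y ⟩
S-act {a} {b} {c} {d} (_ , γ∈Γ) (mkSL₂ p q r s _ , γ′∈Γ , P≈) = _ , mul γ∈Γ γ′∈Γ , record
  { x≈ = row a b
  ; y≈ = row c d
  }
  where
  row : ∀ a b → a * _ + b * _ ≈ (a * p + b * r) * 1ℝ + (a * q + b * s) * 0ℝ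
  row a b = ≈-trans (+-cong (*-cong ≈-refl (_≈²_.x≈ P≈)) (*-cong ≈-refl (_≈²_.y≈ P≈)))
    (solve 6 (λ a b p q r s → a :* (p :* :1 :+ q :* :0) :+ b :* (r :* :1 :+ s :* :0)
      := (a :* p :+ b :* r) :* :1 :+ (a :* q :+ b :* s) :* :0) ≈-refl a b p q r s)

S-shear : ∀ {x y z} → IsInteger z → S ⟨ x , y ⟩ → S ⟨ x + z * φ * y , y ⟩
S-shear {x} {y} {z} iz = λ P∈S → S-resp (record
  { x≈ = solve 3 (λ x y z → :1 :* x :+ z :* :φ :* y := x :+ z :* :φ :* y) ≈-refl x y z
  ; y≈ = solve 2 (λ x y → :0 :* x :+ :1 :* y := y) ≈-refl x y
  }) (S-act (Γ-shear iz) P∈S)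

-- Powers of φ and the reduction of (1 , φ^(2n+1)).

-- In terms of Fibonacci numbers f n = F₂ₙ and g n = F₂ₙ₋₁, so that A n = φ²ⁿ and Ā n = φ⁻²ⁿ.
f g : ℕ → ℝ
f zero    = 0ℝ
f (suc n) = f n + f n + g n
g zero    = 1ℝ
g (suc n) = f n + g n

f-int : ∀ n → IsInteger (f n)
g-int : ∀ n → IsInteger (g n)
f-int zero    = int-0
f-int (suc n) = int-+ (int-+ (f-int n) (f-int n)) (g-int n)
g-int zero    = int-1
g-int (suc n) = int-+ (f-int n) (g-int n)

A Ā : ℕ → ℝ
A n = f n * φ + g n
Ā n = f n * - ψ + g n

-- D n = φ^(n²) and D̄ n = φ^(- n²); the second column of frame n below is (p n , p (1 + n)).
D D̄ p : ℕ → ℝ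
D zero    = 1ℝ
D (suc n) = D n * (A n * φ)
D̄ zero    = 1ℝ
D̄ (suc n) = D̄ n * (Ā n * ψ)
p zero    = 0ℝ
p (suc n) = A n * φ * p n + D̄ n

A-suc : ∀ n → A (suc n) ≈ A n * (φ * φ)
A-suc n = solve 2 (λ f g → (f :+ f :+ g) :* :φ :+ (f :+ g) := (f :* :φ :+ g) :* (:φ :* :φ)) ≈-refl (f n) (g n)

Ā-suc : ∀ n → Ā (suc n) ≈ Ā n * (ψ * ψ)
Ā-suc n = solve 2 (λ f g → (f :+ f :+ g) :* :- :ψ :+ (f :+ g) := (f :* :- :ψ :+ g) :* (:ψ :* :ψ)) ≈-refl (f n) (g n)

A*Ā : ∀ n → A n * Ā n ≈ 1ℝ
A*Ā zero    = solve 0 ((:0 :* :φ :+ :1) :* (:0 :* :- :ψ :+ :1) := :1) ≈-refl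
A*Ā (suc n) = ≈-trans (*-cong (A-suc n) (Ā-suc n)) (≈-trans
  (solve 2 (λ a a′ → a :* (:φ :* :φ) :* (a′ :* (:ψ :* :ψ)) := a :* a′) ≈-refl (A n) (Ā n)) (A*Ā n))

D*D̄ : ∀ n → D n * D̄ n ≈ 1ℝ
D*D̄ zero    = *-identityˡ 1ℝ
D*D̄ (suc n) = ≈-trans
  (solve 4 (λ d d′ a a′ → d :* (a :* :φ) :* (d′ :* (a′ :* :ψ)) := d :* d′ :* (a :* a′)) ≈-refl (D n) (D̄ n) (A n) (Ā n))
  (≈-trans (*-cong (D*D̄ n) (A*Ā n)) (*-identityˡ 1ℝ))

-- For identities that hold only modulo a relation `u ≈ 1ℝ`, here `A n * Ā n ≈ 1ℝ`: the solver
-- checks them with an explicit multiple of `u - 1ℝ` added.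
≈-modulo : ∀ {u x y} z → u ≈ 1ℝ → x ≈ y + z * (u - 1ℝ) → x ≈ y
≈-modulo {u} {x} {y} z u≈1 x≈ = ≈-trans x≈ (≈-trans
  (+-cong ≈-refl (*-cong {z} ≈-refl (+-cong u≈1 (≈-refl { - 1ℝ}))))
  (solve 2 (λ y z → y :+ z :* (:1 :- :1) := y) ≈-refl y z))

-- The shear uses the integer φ^(2n+2) + φ^(-2n-2) = 2 F₂ₙ₊₁ + F₂ₙ₊₂.
frame : ∀ n → Γ[ D n , p n , D n * A n * φ , p (suc n) ]
frame zero    = Γ-resp ≈-refl ≈-refl
  (solve 0 (:φ := :1 :* (:0 :* :φ :+ :1) :* :φ) ≈-refl)
  (solve 0 (:1 := (:0 :* :φ :+ :1) :* :φ :* :0 :+ :1) ≈-refl)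
  (_ , gen (suc (suc (suc zero))))
frame (suc n) = Γ-resp
  (solve 3 (λ d f g → :0 :* d :+ :1 :* (d :* (f :* :φ :+ g) :* :φ) := d :* ((f :* :φ :+ g) :* :φ)) ≈-refl (D n) (f n) (g n))
  (solve 2 (λ p q → :0 :* p :+ :1 :* q := q) ≈-refl (p n) (p (suc n)))
  -- The integer is `A (suc n) + Ā (suc n)`. Its `Ā` part contributes `D n`, because
  -- `A n * Ā n ≈ 1ℝ` and φψ = 1, and this cancels the `D n` subtracted.
  (≈-modulo (D n) (A*Ā n)
    (solve 3 (λ d f g →
      let a = f :* :φ :+ g ; a′ = f :* :- :ψ :+ g
          f⁺ = f :+ f :+ g ; g⁺ = f :+ g
      in :- :1 :* d :+ (g⁺ :+ g⁺ :+ f⁺) :* :φ :* (d :* a :* :φ)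
        := d :* (a :* :φ) :* (f⁺ :* :φ :+ g⁺) :* :φ :+ d :* (a :* a′ :- :1)) ≈-refl (D n) (f n) (g n)))
  (≈-modulo (p n) (A*Ā n)
    (solve 4 (λ d′ p f g →
      let a = f :* :φ :+ g ; a′ = f :* :- :ψ :+ g
          f⁺ = f :+ f :+ g ; g⁺ = f :+ g
          q = a :* :φ :* p :+ d′
      in :- :1 :* p :+ (g⁺ :+ g⁺ :+ f⁺) :* :φ :* q
        := (f⁺ :* :φ :+ g⁺) :* :φ :* q :+ d′ :* (a′ :* :ψ) :+ p :* (a :* a′ :- :1)) ≈-refl (D̄ n) (p n) (f n) (g n)))
  (Γ-mul (Γ-shear-rotation (int-+ (int-+ (g-int (suc n)) (g-int (suc n))) (f-int (suc n)))) (frame n))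

-- Three collinear vectors of S.

-- The common value of x + φ^(2n+1) y on the three sheared vectors (x , y) used below; it equals F₂ₙ
-- φ³ - φ.
h : ℕ → ℝ
h n = (f n * (φ * φ) - 1ℝ) * φ

-- A quarter turn takes (h n - A n φ μ , μ) to (0 , h n) - μ (1 , φ^(2n+1)), and the inverse of frame n
-- makes the direction (1 , φ^(2n+1)) horizontal.
transport : ∀ n {x μ} → x ≈ h n - A n * φ * μ → S ⟨ x , μ ⟩ → S ⟨ - (p n * h n + μ * D̄ n) , D n * h n ⟩
transport n {x} {μ} x≈ P∈S = S-resp (record
  { x≈ = ≈-trans (+-cong (≈-refl {p (suc n) * (0ℝ * x + - 1ℝ * μ)})
             (*-cong (≈-refl { - p n}) (+-cong (*-cong (≈-refl {1ℝ}) x≈) (≈-refl {0ℝ * μ}))))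
           (solve 6 (λ x μ p d′ a h → (a :* :φ :* p :+ d′) :* (:0 :* x :+ :- :1 :* μ)
             :+ :- p :* (:1 :* (h :- a :* :φ :* μ) :+ :0 :* μ) := :- (p :* h :+ μ :* d′)) ≈-refl x μ (p n) (D̄ n) (A n) (h n))
  ; y≈ = ≈-trans (+-cong (≈-refl { - (D n * A n * φ) * (0ℝ * x + - 1ℝ * μ)})
             (*-cong (≈-refl {D n}) (+-cong (*-cong (≈-refl {1ℝ}) x≈) (≈-refl {0ℝ * μ}))))
           (solve 5 (λ x μ d a h → :- (d :* a :* :φ) :* (:0 :* x :+ :- :1 :* μ)
             :+ d :* (:1 :* (h :- a :* :φ :* μ) :+ :0 :* μ) := d :* h) ≈-refl x μ (D n) (A n) (h n))
  })
  (S-act (Γ-inverse (frame n)) (S-act Γ-rotation P∈S))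

-- Only the first coordinate depends on `μ`, with slope -φ^(-n²).
point : ℝ → ℕ → ℝ²
point μ n = ⟨ - (p n * h n + μ * D̄ n) , D n * h n ⟩

-- The vector (0 , 1) is the image of (1 , 0) under the quarter turn. The integer in the shear is
-- the one that gives x + φ^(2n+1) y the value `h n`; the same holds for the next two points.
point₁∈S : ∀ n → S (point 1ℝ n)
point₁∈S n = transport n
  (solve 2 (λ f g → :0 :+ (f :+ :- (g :+ :1)) :* :φ :* :1
    := (f :* (:φ :* :φ) :- :1) :* :φ :- (f :* :φ :+ g) :* :φ :* :1) ≈-refl (f n) (g n))
  (S-shear (int-+ (f-int n) (int-neg (int-+ (g-int n) int-1))) (S-column Γ-rotation))

-- The vector (1 , φ) is the first column of σ₃.
pointφ∈S : ∀ n → S (point φ n)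
pointφ∈S n = transport n
  (solve 2 (λ f g → :1 :+ :- (g :+ :1) :* :φ :* :φ
    := (f :* (:φ :* :φ) :- :1) :* :φ :- (f :* :φ :+ g) :* :φ :* :φ) ≈-refl (f n) (g n))
  (S-shear (int-neg (int-+ (g-int n) int-1)) (S-column (_ , gen (suc (suc (suc zero))))))

-- The vector (2φ² , φ³) is the first column of σ₁ σ₂.
pointφ³∈S : ∀ n → S (point (φ * (φ * φ)) n)
pointφ³∈S n = transport n
  (solve 2 (λ f g → (:1 :+ :1) :* (:φ :* :φ) :+ :- (f :+ g :+ :1) :* :φ :* (:φ :* (:φ :* :φ))
    := (f :* (:φ :* :φ) :- :1) :* :φ :- (f :* :φ :+ g) :* :φ :* (:φ :* (:φ :* :φ))) ≈-refl (f n) (g n))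
  (S-shear (int-neg (int-+ (int-+ (f-int n) (g-int n)) int-1)) (S-resp (record
    { x≈ = solve 0 (:φ :* :φ :+ :φ :* :φ := (:1 :+ :1) :* (:φ :* :φ)) ≈-refl
    ; y≈ = solve 0 (:1 :* :φ :+ :φ :* :φ := :φ :* (:φ :* :φ)) ≈-refl
    }) (S-column (Γ-mul (_ , gen (suc zero)) (_ , gen (suc (suc zero)))))))

-- Size estimates.

≤-by : ∀ {x y z} → 0ℝ ≤ z → y ≈ x + z → x ≤ y
≤-by {x} {y} {z} 0≤z y≈x+z = ≤-resp-≈ (+-identityʳ x) (≈-sym y≈x+z) (+-mono-≤ ≤-refl 0≤z)

0≤1 : 0ℝ ≤ 1ℝ
0≤1 = <⇒≤ 0<1ℝ

φ³ : ℝ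
φ³ = φ * (φ * φ)

0≤φ³ : 0ℝ ≤ φ³
0≤φ³ = 0≤* 0≤φ (0≤square φ)

0≤f : ∀ n → 0ℝ ≤ f n
0≤g : ∀ n → 0ℝ ≤ g n
0≤f zero    = ≤-refl
0≤f (suc n) = 0≤+ (0≤+ (0≤f n) (0≤f n)) (0≤g n)
0≤g zero    = 0≤1
0≤g (suc n) = 0≤+ (0≤f n) (0≤g n)

1≤* : ∀ {x y} → 1ℝ ≤ x → 1ℝ ≤ y → 1ℝ ≤ x * y
1≤* 1≤x 1≤y = ≤-resp-≈ (*-identityˡ 1ℝ) ≈-refl (*-mono-≤ 0≤1 (≤-trans 0≤1 1≤y) 1≤x 1≤y)

1≤A : ∀ n → 1ℝ ≤ A n
1≤A zero    = ≈⇒≤ (solve 0 (:1 := :0 :* :φ :+ :1) ≈-refl)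
1≤A (suc n) = ≤-resp-≈ ≈-refl (≈-sym (A-suc n)) (1≤* (1≤A n) (1≤* 1≤φ 1≤φ))

1≤D : ∀ n → 1ℝ ≤ D n
1≤D zero    = ≤-refl
1≤D (suc n) = 1≤* (1≤D n) (1≤* (1≤A n) 1≤φ)

0<Ā : ∀ n → 0ℝ < Ā n
0<Ā zero    = <-resp-≈ ≈-refl (solve 0 (:1 := :0 :* :- :ψ :+ :1) ≈-refl) 0<1ℝ
0<Ā (suc n) = <-resp-≈ ≈-refl (≈-sym (Ā-suc n)) (0<* (0<Ā n) (0<* 0<ψ 0<ψ))

0<D̄ : ∀ n → 0ℝ < D̄ n
0<D̄ zero    = 0<1ℝ
0<D̄ (suc n) = 0<* (0<D̄ n) (0<* (0<Ā n) 0<ψ)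

0≤A : ∀ n → 0ℝ ≤ A n
0≤A n = ≤-trans 0≤1 (1≤A n)

0≤D : ∀ n → 0ℝ ≤ D n
0≤D n = ≤-trans 0≤1 (1≤D n)

0≤D̄ : ∀ n → 0ℝ ≤ D̄ n
0≤D̄ n = <⇒≤ (0<D̄ n)

D̄≤1 : ∀ n → D̄ n ≤ 1ℝ
D̄≤1 n = ≤-resp-≈ (*-identityˡ (D̄ n)) (D*D̄ n) (*-mono-≤ 0≤1 (0≤D̄ n) (1≤D n) ≤-refl)

-- In exponents of φ this is 2n ≤ n² + 1.
A≤φ*D : ∀ n → A n ≤ φ * D n
A≤φ*D zero    = ≤-by 0≤ψ (solve 0 (:φ :* :1 := :0 :* :φ :+ :1 :+ :ψ) ≈-refl)
A≤φ*D (suc n) = ≤-by (0≤* (0≤* (0≤A n) (0≤* 0≤φ 0≤φ)) (0≤y-x (1≤D n))) (≈-trans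
  (solve 2 (λ d a → :φ :* (d :* (a :* :φ)) := a :* (:φ :* :φ) :+ a :* (:φ :* :φ) :* (d :- :1)) ≈-refl (D n) (A n))
  (+-cong (≈-sym (A-suc n)) ≈-refl))

0≤p : ∀ n → 0ℝ ≤ p n
0≤p zero    = ≤-refl
0≤p (suc n) = 0≤+ (0≤* (0≤* (0≤A n) 0≤φ) (0≤p n)) (0≤D̄ n)

-- Passing to `suc n` multiplies the right side by φ⁵ `A n`, while `p n` is multiplied by φ `A n`
-- and increased by at most 1. The slack is φ⁵ = φ + 1 + 2φ³.
p≤D*A² : ∀ n → p n ≤ D n * (A n * A n)
p≤D*A² zero    = 0≤* 0≤1 (0≤square (A 0))
p≤D*A² (suc n) = ≤-trans
  (+-mono-≤ (*-mono-≤ (0≤* (0≤A n) 0≤φ) (0≤* (0≤D n) (0≤square (A n))) ≤-refl (p≤D*A² n))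
    (≤-trans (D̄≤1 n) (1≤* (1≤* (1≤D n) (1≤* (1≤A n) (1≤A n))) (1≤A n))))
  (≤-by (0≤* (0≤* (0≤* (0≤D n) (0≤square (A n))) (0≤A n)) (0≤+ 0≤φ³ 0≤φ³))
    (≈-trans (*-cong ≈-refl (*-cong (A-suc n) (A-suc n)))
      (solve 2 (λ d a → d :* (a :* :φ) :* (a :* (:φ :* :φ) :* (a :* (:φ :* :φ)))
        := a :* :φ :* (d :* (a :* a)) :+ d :* (a :* a) :* a
          :+ d :* (a :* a) :* a :* (:φ :* (:φ :* :φ) :+ :φ :* (:φ :* :φ)))
        ≈-refl (D n) (A n))))

∣h∣≤ : ∀ n → ∣ h n ∣≤ (A n * (φ * φ))
∣h∣≤ n =
  ≤-by (0≤+ (0≤+ (0≤* (0≤f n) (0≤* 0≤φ (0≤* 0≤φ 0≤φ))) (0≤* (0≤y-x (1≤A n)) (0≤square φ))) 0≤1)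
    (solve 2 (λ f g → let a = f :* :φ :+ g in (f :* (:φ :* :φ) :- :1) :* :φ
      := :- (a :* (:φ :* :φ)) :+ (f :* (:φ :* (:φ :* :φ)) :+ (a :- :1) :* (:φ :* :φ) :+ :1)) ≈-refl (f n) (g n)) ,
  ≤-by (0≤+ (0≤* (0≤g n) (0≤square φ)) 0≤φ)
    (solve 2 (λ f g → (f :* :φ :+ g) :* (:φ :* :φ)
      := (f :* (:φ :* :φ) :- :1) :* :φ :+ (g :* (:φ :* :φ) :+ :φ)) ≈-refl (f n) (g n))

-- Relative to `D⁴ n`, the summand φ⁵ bounds `p n * h n` and φ³ bounds `μ * D̄ n`.
K : ℝ
K = φ * φ * φ³ + φ³

D⁴ : ℕ → ℝ
D⁴ n = D n ^ 4

1≤D⁴ : ∀ n → 1ℝ ≤ D⁴ n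
1≤D⁴ n = 1≤* (1≤D n) (1≤* (1≤D n) (1≤* (1≤D n) (1≤* (1≤D n) ≤-refl)))

-- The source of the fourth power: the product `p n * h n` is at most D A² times A φ², and each of
-- the three factors A is at most φ D.
∣x∣≤ : ∀ n {μ} → 0ℝ ≤ μ → μ ≤ φ³ → ∣ - (p n * h n + μ * D̄ n) ∣≤ (K * D⁴ n)
∣x∣≤ n {μ} 0≤μ μ≤φ³ = ∣∣≤-weaken
  (∣-∣≤ (∣+∣≤ (∣*∣≤ (0≤⇒∣∣≤ (0≤p n) (p≤D*A² n)) (∣h∣≤ n)) (∣*∣≤ (0≤⇒∣∣≤ 0≤μ μ≤φ³) (0≤⇒∣∣≤ (0≤D̄ n) (D̄≤1 n)))))
  (≤-trans (+-mono-≤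
      (*-mono-≤ (0≤* (0≤D n) (0≤square (A n))) (0≤* 0≤φD (0≤square φ))
        (*-mono-≤ (0≤D n) (0≤square (φ * D n)) ≤-refl (*-mono-≤ (0≤A n) 0≤φD (A≤φ*D n) (A≤φ*D n)))
        (*-mono-≤ (0≤A n) (0≤square φ) (A≤φ*D n) ≤-refl))
      (*-mono-≤ 0≤φ³ (≤-trans 0≤1 (1≤D⁴ n)) ≤-refl (1≤D⁴ n)))
    (≈⇒≤ (solve 1 (λ d → let φ³ = :φ :* (:φ :* :φ) ; d⁴ = d :* (d :* (d :* (d :* :1))) in
      d :* (:φ :* d :* (:φ :* d)) :* (:φ :* d :* (:φ :* :φ)) :+ φ³ :* d⁴
      := (:φ :* :φ :* φ³ :+ φ³) :* d⁴) ≈-refl (D n))))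
  where
  0≤φD : 0ℝ ≤ φ * D n
  0≤φD = 0≤* 0≤φ (0≤D n)

∣y∣≤ : ∀ n → ∣ D n * h n ∣≤ (K * D⁴ n)
∣y∣≤ n = ∣∣≤-weaken (∣*∣≤ (0≤⇒∣∣≤ (0≤D n) ≤-refl) (∣h∣≤ n)) (≤-trans
  (*-mono-≤ (0≤D n) (0≤* (0≤* 0≤φ (0≤D n)) (0≤square φ)) ≤-refl (*-mono-≤ (0≤A n) (0≤square φ) (A≤φ*D n) ≤-refl))
  (≤-by (0≤+ (0≤* (0≤* 0≤φ³ (0≤square (D n))) (0≤y-x (1≤* (1≤D n) (1≤D n))))
          (0≤* (0≤* (0≤square φ) 0≤φ³) (≤-trans 0≤1 (1≤D⁴ n))))
    (solve 1 (λ d → let φ³ = :φ :* (:φ :* :φ) ; d⁴ = d :* (d :* (d :* (d :* :1))) in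
      (:φ :* :φ :* φ³ :+ φ³) :* d⁴
      := d :* (:φ :* d :* (:φ :* :φ)) :+ (φ³ :* (d :* d) :* (d :* d :- :1) :+ :φ :* :φ :* φ³ :* d⁴)) ≈-refl (D n))))

-- The length ε and the radius.

-- The parameters 1, φ and φ³ lie in [0 , φ³], on which the first coordinate of `point` varies by
-- exactly this amount.
ε : ℕ → ℝ
ε n = φ³ * D̄ n

0<φ³ : 0ℝ < φ³
0<φ³ = 0<* 0<φ (0<* 0<φ 0<φ)

0<ε : ∀ n → 0ℝ < ε n
0<ε n = 0<* 0<φ³ (0<D̄ n)

inv-unique : ∀ {x y} (x#0 : x # 0ℝ) → x * y ≈ 1ℝ → inv x x#0 ≈ y
inv-unique {x} {y} x#0 xy≈1 = ≈-trans (≈-sym (*-identityʳ (inv x x#0))) (≈-trans (*-cong ≈-refl (≈-sym xy≈1)) (≈-trans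
  (solve 3 (λ i x y → i :* (x :* y) := x :* i :* y) ≈-refl (inv x x#0) x y)
  (≈-trans (*-cong (inv-inverseʳ x x#0) ≈-refl) (*-identityˡ y))))

ψ³ : ℝ
ψ³ = ψ * (ψ * ψ)

inv-ε : ∀ n → inv (ε n) (inj₂ (0<ε n)) ≈ ψ³ * D n
inv-ε n = inv-unique (inj₂ (0<ε n)) (≈-trans
  (solve 2 (λ d d′ → :φ :* (:φ :* :φ) :* d′ :* (:ψ :* (:ψ :* :ψ) :* d) := d :* d′) ≈-refl (D n) (D̄ n)) (D*D̄ n))

-- The factor 2 comes from `square∈Ball`, and the fourth power of φ³ cancels that of ψ³ in the
-- inverse of `ε n`.
C : ℝ
C = 2ℝ * (K * φ³ ^ 4)

2K*D⁴≈radius : ∀ n → 2ℝ * (K * D⁴ n) ≈ C * (inv (ε n) (inj₂ (0<ε n)) ^ 4)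
2K*D⁴≈radius n = ≈-sym (≈-trans (*-cong ≈-refl (^-congˡ 4 (inv-ε n)))
  (solve 2 (λ k d →
    let c = :φ :* (:φ :* :φ) ; e = :ψ :* (:ψ :* :ψ) :* d in
    (:1 :+ :1) :* (k :* (c :* (c :* (c :* (c :* :1))))) :* (e :* (e :* (e :* (e :* :1))))
    := (:1 :+ :1) :* (k :* (d :* (d :* (d :* (d :* :1)))))) ≈-refl K (D n)))

0<+ : ∀ {x y} → 0ℝ < x → 0ℝ < y → 0ℝ < x + y
0<+ {x} 0<x 0<y = ≤-<-trans (<⇒≤ 0<x) (<-resp-≈ (+-identityʳ x) ≈-refl (+-monoʳ-< x 0<y))

0<K : 0ℝ < K
0<K = 0<+ (0<* (0<* 0<φ 0<φ) 0<φ³) 0<φ³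

0<C : 0ℝ < C
0<C = 0<* (0<+ 0<1ℝ 0<1ℝ) (0<* 0<K (0<* 0<φ³ (0<* 0<φ³ (0<* 0<φ³ (0<* 0<φ³ 0<1ℝ)))))

point∈Ball : ∀ n {μ} → 0ℝ ≤ μ → μ ≤ φ³ → Ball origin (C * (inv (ε n) (inj₂ (0<ε n)) ^ 4)) (point μ n)
point∈Ball n 0≤μ μ≤φ³ = <-≤-trans
  (square∈Ball (0<* 0<K (<-≤-trans 0<1ℝ (1≤D⁴ n))) (∣x∣≤ n 0≤μ μ≤φ³) (∣y∣≤ n)) (≈⇒≤ (2K*D⁴≈radius n))

-- Convergence of ε to zero.

grid-mono : ∀ {m n} → m ℕ.≤ n → grid 0 m ℚ.≤ grid 0 n
grid-mono {m} m≤n = go (ℕ.≤⇒≤′ m≤n)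
  where
  go : ∀ {n} → m ℕ.≤′ n → grid 0 m ℚ.≤ grid 0 n
  go ℕ.≤′-refl = ℚ.≤-refl
  go (ℕ.≤′-step {n} h) = ℚ.≤-trans (go h) (subst (grid 0 n ℚ.≤_) (sym (grid-suc 0 n)) (p≤p+q (grid 0 n) 0<1))

-- Here `grid 0 n` is the rational number n. Each step multiplies `D n` by at least φ = 1 + ψ and so
-- adds at least ψ; this linear growth suffices for the limit.
ψ*n≤D : ∀ n → ψ * fromℚ (grid 0 n) ≤ D n
ψ*n≤D zero    = ≤-by 0≤1 (solve 0 (:1 := :ψ :* :0 :+ :1) ≈-refl)
ψ*n≤D (suc n) = subst (λ q → ψ * fromℚ q ≤ D (suc n)) (sym (grid-suc 0 n)) (≤-trans
  (≤-trans (≈⇒≤ {y = ψ * fromℚ (grid 0 n) + ψ * 1ℝ} (pointwise λ i → ℚ.*-distribˡ-+ (seq ψ i) (grid 0 n) 1ℚ))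
    (+-mono-≤ (ψ*n≤D n) (*-mono-≤ 0≤ψ (0≤D n) ≤-refl (1≤D n))))
  (≤-by (0≤* (0≤* (0≤D n) (0≤y-x (1≤A n))) 0≤φ)
    (solve 2 (λ d a → d :* (a :* :φ) := d :+ :ψ :* d :+ d :* (a :- :1) :* :φ) ≈-refl (D n) (A n))))

8ℚ : ℚ
8ℚ = + 8 ℚ./ 1

-- This rests on 8ψ = φ³ + 3ψ³. The factor ψ matches the one in `ψ*n≤D`, so that only a comparison
-- of rationals remains.
ε≤8*ψ*D̄ : ∀ n → ε n ≤ fromℚ 8ℚ * ψ * D̄ n
ε≤8*ψ*D̄ n = ≤-by (0≤* (0≤* (fromℚ-mono-≤ (ℚ.<⇒≤ (ℚ.positive⁻¹ (+ 3 ℚ./ 1)))) (0≤* 0≤ψ (0≤square ψ))) (0≤D̄ n))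
  (solve 1 (λ d′ → con (8ℚ , 0ℚ) :* :ψ :* d′
    := :φ :* (:φ :* :φ) :* d′ :+ con (+ 3 ℚ./ 1 , 0ℚ) :* (:ψ :* (:ψ :* :ψ)) :* d′) ≈-refl (D̄ n))

-- Once n ≥ 8/d, 8ψ ≤ dψn ≤ d `D n`; multiplying by `D̄ n` leaves d.
ε≤d : ∀ {d r} → 0ℚ ℚ.< d → d ℚ.* r ≡ 1ℚ → ∀ n → 8ℚ ℚ.* r ℚ.≤ grid 0 n → ε n ≤ fromℚ d
ε≤d {d} {r} 0<d dr≡1 n 8r≤n = ≤-trans (ε≤8*ψ*D̄ n) (≤-trans (*-mono-≤ 0≤8ψ (0≤D̄ n) 8ψ≤d*D ≤-refl) (≈⇒≤ d*D*D̄≈d))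
  where
  0≤8ψ : 0ℝ ≤ fromℚ 8ℚ * ψ
  0≤8ψ = 0≤* (fromℚ-mono-≤ (ℚ.<⇒≤ (ℚ.positive⁻¹ 8ℚ))) 0≤ψ
  8≤d*n : fromℚ 8ℚ ≤ fromℚ (d ℚ.* grid 0 n)
  8≤d*n = fromℚ-mono-≤ (subst (ℚ._≤ d ℚ.* grid 0 n)
    (trans (ℚS.solve 3 (λ d e r → d ℚS.:* (e ℚS.:* r) ℚS.:= d ℚS.:* r ℚS.:* e) refl d 8ℚ r)
      (trans (cong (ℚ._* 8ℚ) dr≡1) (ℚ.*-identityˡ 8ℚ)))
    (ℚ.*-monoˡ-≤-nonNeg d {{ℚ.nonNegative (ℚ.<⇒≤ 0<d)}} 8r≤n))
  d*n*ψ≈ : fromℚ (d ℚ.* grid 0 n) * ψ ≈ fromℚ d * (ψ * fromℚ (grid 0 n))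
  d*n*ψ≈ = pointwise λ i → ℚS.solve 3 (λ d m t → d ℚS.:* m ℚS.:* t ℚS.:= d ℚS.:* (t ℚS.:* m)) refl d (grid 0 n) (seq ψ i)
  8ψ≤d*D : fromℚ 8ℚ * ψ ≤ fromℚ d * D n
  8ψ≤d*D = ≤-trans (*-mono-≤ (fromℚ-mono-≤ (ℚ.<⇒≤ (ℚ.positive⁻¹ 8ℚ))) 0≤ψ 8≤d*n ≤-refl)
    (≤-trans (≈⇒≤ d*n*ψ≈) (*-mono-≤ (fromℚ-mono-≤ (ℚ.<⇒≤ 0<d)) (0≤D n) ≤-refl (ψ*n≤D n)))
  d*D*D̄≈d : fromℚ d * D n * D̄ n ≈ fromℚ d
  d*D*D̄≈d = ≈-trans (*-assoc (fromℚ d) (D n) (D̄ n))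
    (≈-trans (*-cong (≈-refl {fromℚ d}) (D*D̄ n)) (*-identityʳ (fromℚ d)))

ε-small : ∀ {d} → 0ℚ ℚ.< d → Eventually λ n → ε n ≤ fromℚ d
ε-small {d} 0<d with recip 0<d
... | r , _ , dr≡1 with grid-unbounded 0 (8ℚ ℚ.* r)
...   | k , 8r≤k = k , λ n k≤n → ε≤d 0<d dr≡1 n (ℚ.≤-trans 8r≤k (grid-mono k≤n))

half-gap<δ : ∀ {δ} (0<δ : 0ℝ < δ) → fromℚ (gap 0<δ ℚ.* ½) < δ
half-gap<δ {δ} (mk< g 0<g (N , g≤δ)) = mk< (g ℚ.* ½) (half-pos 0<g) (N , λ i N≤i →
  subst (ℚ._≤ seq δ i) (trans (ℚ.+-identityˡ g) (sym (half+half g))) (g≤δ i N≤i))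

ε→0 : ε ConvergesTo 0ℝ
ε→0 δ 0<δ = proj₁ small , λ n k≤n →
  <-≤-trans 0-δ<0 (<⇒≤ (0<ε n)) ,
  <-≤-trans (≤-<-trans (proj₂ small n k≤n) (half-gap<δ 0<δ)) (≈⇒≤ (≈-sym (+-identityˡ δ)))
  where
  small : Eventually λ n → ε n ≤ fromℚ (gap 0<δ ℚ.* ½)
  small = ε-small (half-pos (gap>0 0<δ))
  0-δ<0 : 0ℝ - δ < 0ℝ
  0-δ<0 = <-resp-≈ (+-comm (- δ) 0ℝ) (+-inverseˡ δ) (+-monoʳ-< (- δ) 0<δ)

-- The horizontal segment and its three points.

x-antitone : ∀ n {μ ν} → μ < ν → ℝ².x (point ν n) < ℝ².x (point μ n)
x-antitone n {μ} {ν} μ<ν = <-resp-≈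
  (solve 4 (λ c μ ν d → :- (c :+ (μ :+ ν) :* d) :+ d :* μ := :- (c :+ ν :* d)) ≈-refl (p n * h n) μ ν (D̄ n))
  (solve 4 (λ c μ ν d → :- (c :+ (μ :+ ν) :* d) :+ d :* ν := :- (c :+ μ :* d)) ≈-refl (p n * h n) μ ν (D̄ n))
  -- Translating `D̄ n * μ < D̄ n * ν` by a term containing μ + ν exchanges the two parameters and
  -- their signs.
  (+-monoʳ-< (- (p n * h n + (μ + ν) * D̄ n)) (*-monoʳ-< (0<D̄ n) μ<ν))

point-apart : ∀ n {μ ν} → μ < ν → point μ n #² point ν n
point-apart n μ<ν = inj₁ (inj₂ (x-antitone n μ<ν))

-- The endpoints are the first coordinates at μ = φ³ and μ = 0, so the third point is the left
-- endpoint.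
segment : ℕ → HorizontalSegment
segment n = record
  { left       = - (p n * h n + ε n)
  ; right      = - (p n * h n)
  ; height     = D n * h n
  ; left≤right = ≤-by (<⇒≤ (0<ε n)) (solve 2 (λ c e → :- c := :- (c :+ e) :+ e) ≈-refl (p n * h n) (ε n))
  }

segment-length : ∀ n → HorizontalSegment.length (segment n) ≈ ε n
segment-length n = solve 2 (λ c e → :- c :- :- (c :+ e) := e) ≈-refl (p n * h n) (ε n)

point∈segment : ∀ n {μ} → 0ℝ ≤ μ → μ ≤ φ³ → point μ n ∈ˢ segment n
point∈segment n {μ} 0≤μ μ≤φ³ =
  ≤-by (0≤* (0≤y-x μ≤φ³) (0≤D̄ n))
    (solve 4 (λ c μ ν d → :- (c :+ μ :* d) := :- (c :+ ν :* d) :+ (ν :- μ) :* d) ≈-refl (p n * h n) μ φ³ (D̄ n)) ,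
  ≤-by (0≤* 0≤μ (0≤D̄ n)) (solve 2 (λ c e → :- c := :- (c :+ e) :+ e) ≈-refl (p n * h n) (μ * D̄ n)) ,
  ≈-refl

1<φ : 1ℝ < φ
1<φ = <-resp-≈ (+-identityʳ 1ℝ) (solve 0 (:1 :+ :ψ := :φ) ≈-refl) (+-monoʳ-< 1ℝ 0<ψ)

φ<φ³ : φ < φ³
φ<φ³ = <-resp-≈ (+-identityʳ φ) (solve 0 (:φ :+ :φ :* :φ := :φ :* (:φ :* :φ)) ≈-refl) (+-monoʳ-< φ (0<* 0<φ 0<φ))

1<φ³ : 1ℝ < φ³
1<φ³ = ≤-<-trans 1≤φ φ<φ³

theorem1p6 : Σ (ℕ → ℝ) λ ε →
    Σ (∀ n → 0ℝ < ε n) λ ε>0 →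
    (ε ConvergesTo 0ℝ) ×
    Σ ℝ λ C →
    (0ℝ < C) ×
    (∀ n →
    Σ ℝ² λ P → Σ ℝ² λ Q → Σ ℝ² λ R →
    (S P × S Q × S R) ×
    (P #² Q × Q #² R × P #² R) ×
    (Σ HorizontalSegment λ I →
    (HorizontalSegment.length I ≈ ε n) × (P ∈ˢ I) × (Q ∈ˢ I) × (R ∈ˢ I)) ×
    (let radius = C * (inv (ε n) (inj₂ (ε>0 n)) ^ 4) in
    Ball origin radius P × Ball origin radius Q × Ball origin radius R))
theorem1p6 = ε , 0<ε , ε→0 , C , 0<C , λ n →
  point 1ℝ n , point φ n , point φ³ n ,
  (point₁∈S n , pointφ∈S n , pointφ³∈S n) ,
  (point-apart n 1<φ , point-apart n φ<φ³ , point-apart n 1<φ³) ,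
  (segment n , segment-length n ,
    point∈segment n 0≤1 (<⇒≤ 1<φ³) , point∈segment n 0≤φ (<⇒≤ φ<φ³) , point∈segment n 0≤φ³ ≤-refl) ,
  point∈Ball n 0≤1 (<⇒≤ 1<φ³) , point∈Ball n 0≤φ (<⇒≤ φ<φ³) , point∈Ball n 0≤φ³ ≤-refl
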